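{- Let $n\geq l\geq 3$ be integers. If $G$ is an $n$-vertex unicyclic graph with girth $l$, then for every integer $k\geq 0$, $$n_k(US_n^l)\geq n_k(G)\geq n_k(UP_n^l).$$
   Context: A unicyclic graph is a connected graph containing exactly one cycle; its girth is the length of that cycle. A subtree of a graph $G$ is a subgraph of $G$ that is a tree (subtrees are distinguished as subgraphs); $n_k(G)$ is the number of subtrees of $G$ with exactly $k$ vertices, with the convention $n_0(G)=1$. $US_n^l$ is the graph obtained from the cycle $C_l$ by attaching $n-l$ pendent vertices to one vertex of the cycle. $UP_n^l$ is the graph obtained from $C_l$ by attaching a pendent path of length $n-l$ (i.e. with $n-l$ new vertices) to one vertex of the cycle. -}

module Defs where

open import Data.Bool.Base using (Bool; true; false)
open import Data.Fin.Base using (Fin; toℕ)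
import Data.Fin.Properties as Fin
open import Data.Fin.Subset using (Subset; _∈_; Nonempty; ∣_∣)
open import Data.Fin.Subset.Properties using (_∈?_; nonempty?)
open import Data.List.Base as List using (List; []; _∷_; allFin; cartesianProductWith; filter)
import Data.List.Membership.Propositional as List∈
open import Data.List.Membership.Propositional.Properties using (∈-allFin)
open import Data.List.Relation.Unary.Any using (here; there)
open import Data.Nat.Base using (ℕ; zero; suc; _≤_; _<_; s≤s)
open import Data.Nat.Properties using (_≟_; _≤?_; _<?_; anyUpTo?)
open import Data.Product.Base using (∃; ∃₂; _×_; _,_)
open import Data.Sum.Base as Sum using (_⊎_; inj₁; inj₂)
open import Data.Vec.Base using (Vec; []; _∷_; lookup)
open import Function.Base using (id; _∘_)
open import Function.Bundles using (_⇔_)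
open import Function.Definitions using (Injective)
open import Level using (0ℓ)
open import Relation.Binary.Construct.Closure.ReflexiveTransitive using (Star; ε; _◅_; _◅◅_)
open import Relation.Binary.Core using (Rel)
open import Relation.Binary.Definitions using (Decidable; Symmetric; Irreflexive)
open import Relation.Binary.PropositionalEquality.Core using (_≡_; _≢_; refl; ≢-sym)
open import Relation.Nullary.Decidable using (Dec; yes; no; ¬?; map′; _×-dec_; _⊎-dec_; _→-dec_)
open import Relation.Nullary.Negation using (¬_)
import Relation.Unary as U

private
  variable
    n : ℕ

------------------------------------------------------------------------
-- Finite simple graphs

record Graph (n : ℕ) : Set₁ where
  field
    Adj    : Rel (Fin n) 0ℓ
    adj?   : Decidable Adj
    sym    : Symmetric Adj
    irrefl : Irreflexive _≡_ Adj

open Graph public using (Adj; adj?)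

fromEdges : (E : Rel ℕ 0ℓ) → Decidable E → (n : ℕ) → Graph n
fromEdges E E? n = record
  { Adj    = λ u v → u ≢ v × (E (toℕ u) (toℕ v) ⊎ E (toℕ v) (toℕ u))
  ; adj?   = λ u v → ¬? (u Fin.≟ v) ×-dec (E? (toℕ u) (toℕ v) ⊎-dec E? (toℕ v) (toℕ u))
  ; sym    = λ (u≢v , e) → ≢-sym u≢v , Sum.swap e
  ; irrefl = λ u≡v (u≢v , _) → u≢v u≡v
  }

------------------------------------------------------------------------
-- Cycles

-- The edges of C_l on the vertices 0, …, l - 1, oriented i → i + 1 (mod l).

CycleEdge : ℕ → Rel ℕ 0ℓ
CycleEdge l i j = (suc i ≡ j × j < l) ⊎ (suc i ≡ l × j ≡ 0)

cycleEdge? : ∀ l → Decidable (CycleEdge l)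
cycleEdge? l i j = (suc i ≟ j ×-dec j <? l) ⊎-dec (suc i ≟ l ×-dec j ≟ 0)

record IsCycle (R : Rel (Fin n) 0ℓ) {m : ℕ} (c : Vec (Fin n) m) : Set where
  field
    long     : 3 ≤ m
    distinct : Injective _≡_ _≡_ (lookup c)
    closed   : ∀ i j → CycleEdge m (toℕ i) (toℕ j) → R (lookup c i) (lookup c j)

record Cycle (R : Rel (Fin n) 0ℓ) : Set where
  constructor cycle
  field
    {length} : ℕ
    vertices : Vec (Fin n) length
    isCycle  : IsCycle R vertices

  On : Rel (Fin n) 0ℓ
  On u v = ∃₂ λ i j → CycleEdge length (toℕ i) (toℕ j) ×
    ((u ≡ lookup vertices i × v ≡ lookup vertices j) ⊎
     (u ≡ lookup vertices j × v ≡ lookup vertices i))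

-- Cycles are identified when they are the same subgraph, so the choice of
-- starting point and direction in the vertex sequence is immaterial.

SameCycle : {R : Rel (Fin n) 0ℓ} → Rel (Cycle R) 0ℓ
SameCycle c d = ∀ u v → Cycle.On c u v ⇔ Cycle.On d u v

Acyclic : Rel (Fin n) 0ℓ → Set
Acyclic R = ¬ Cycle R

------------------------------------------------------------------------
-- Unicyclic graphs

record Unicyclic (G : Graph n) : Set where
  field
    connected   : ∀ u v → Star (Adj G) u v
    theCycle    : Cycle (Adj G)
    uniqueCycle : ∀ c → SameCycle theCycle c

girth : {G : Graph n} → Unicyclic G → ℕ
girth U = Cycle.length (Unicyclic.theCycle U)

-- In both graphs below, 0, …, l - 1 span C_l, the attachment vertex is 0, and
-- l, …, n - 1 are the new vertices.  They are meaningful for 3 ≤ l ≤ n.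

USEdge : ℕ → Rel ℕ 0ℓ
USEdge l i j = CycleEdge l i j ⊎ (i ≡ 0 × l ≤ j)

usEdge? : ∀ l → Decidable (USEdge l)
usEdge? l i j = cycleEdge? l i j ⊎-dec (i ≟ 0 ×-dec l ≤? j)

US : (n l : ℕ) → Graph n
US n l = fromEdges (USEdge l) (usEdge? l) n

UPEdge : ℕ → Rel ℕ 0ℓ
UPEdge l i j = CycleEdge l i j ⊎ (i ≡ 0 × j ≡ l) ⊎ (l ≤ i × j ≡ suc i)

upEdge? : ∀ l → Decidable (UPEdge l)
upEdge? l i j = cycleEdge? l i j ⊎-dec (i ≟ 0 ×-dec j ≟ l) ⊎-dec (l ≤? i ×-dec j ≟ suc i)

UP : (n l : ℕ) → Graph n
UP n l = fromEdges (UPEdge l) (upEdge? l) n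

------------------------------------------------------------------------
-- Subtrees

-- A vertex set together with an adjacency matrix: two subgraphs are equal
-- exactly when they are propositionally equal in this representation.

record VertexEdgeSets (n : ℕ) : Set where
  constructor ⟨_,_⟩
  field
    vertices : Subset n
    edges    : Vec (Subset n) n

open VertexEdgeSets public using (vertices; edges)

Edge : VertexEdgeSets n → Rel (Fin n) 0ℓ
Edge H u v = v ∈ lookup (edges H) u

edge? : (H : VertexEdgeSets n) → Decidable (Edge H)
edge? H u v = v ∈? lookup (edges H) u

record IsSubgraph (G : Graph n) (H : VertexEdgeSets n) : Set where
  field
    symmetric : ∀ u v → Edge H u v → Edge H v u
    endpoints : ∀ u v → Edge H u v → u ∈ vertices H × v ∈ vertices H
    adjacent  : ∀ u v → Edge H u v → Adj G u v

record IsTree (H : VertexEdgeSets n) : Set where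
  field
    nonempty  : Nonempty (vertices H)
    connected : ∀ u v → u ∈ vertices H → v ∈ vertices H → Star (Edge H) u v
    acyclic   : Acyclic (Edge H)

record IsSubtree (G : Graph n) (k : ℕ) (H : VertexEdgeSets n) : Set where
  field
    isSubgraph : IsSubgraph G H
    isTree     : IsTree H
    size       : ∣ vertices H ∣ ≡ k

------------------------------------------------------------------------
-- Decidability of being a subtree

-- Warshall's algorithm: Via R ws u v holds if v is reachable from u with all
-- intermediate vertices in ws.

module _ {R : Rel (Fin n) 0ℓ} where

  Via : List (Fin n) → Rel (Fin n) 0ℓ
  Via []       u v = u ≡ v ⊎ R u v
  Via (w ∷ ws) u v = Via ws u v ⊎ (Via ws u w × Via ws w v)

  via? : Decidable R → ∀ ws → Decidable (Via ws)
  via? R? []       u v = (u Fin.≟ v) ⊎-dec R? u v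
  via? R? (w ∷ ws) u v = via? R? ws u v ⊎-dec (via? R? ws u w ×-dec via? R? ws w v)

  via⇒star : ∀ ws {u v} → Via ws u v → Star R u v
  via⇒star []       (inj₁ refl)    = ε
  via⇒star []       (inj₂ r)       = r ◅ ε
  via⇒star (w ∷ ws) (inj₁ p)       = via⇒star ws p
  via⇒star (w ∷ ws) (inj₂ (p , q)) = via⇒star ws p ◅◅ via⇒star ws q

  via-base : ∀ ws {u v} → u ≡ v ⊎ R u v → Via ws u v
  via-base []       p = p
  via-base (w ∷ ws) p = inj₁ (via-base ws p)

  via-trans : ∀ ws {u x v} → x List∈.∈ ws → Via ws u x → Via ws x v → Via ws u v
  via-trans (w ∷ ws) (here refl) p q =
    inj₂ (Sum.[ id , (λ (p′ , _) → p′) ] p , Sum.[ id , (λ (_ , q′) → q′) ] q)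
  via-trans (w ∷ ws) (there x∈) (inj₁ p)       (inj₁ q)       = inj₁ (via-trans ws x∈ p q)
  via-trans (w ∷ ws) (there x∈) (inj₁ p)       (inj₂ (q , r)) = inj₂ (via-trans ws x∈ p q , r)
  via-trans (w ∷ ws) (there x∈) (inj₂ (p , q)) (inj₁ r)       = inj₂ (p , via-trans ws x∈ q r)
  via-trans (w ∷ ws) (there x∈) (inj₂ (p , _)) (inj₂ (_ , r)) = inj₂ (p , r)

  star⇒via : ∀ {u v} → Star R u v → Via (allFin n) u v
  star⇒via ε        = via-base (allFin n) (inj₁ refl)
  star⇒via (r ◅ rs) =
    via-trans (allFin n) (∈-allFin _) (via-base (allFin n) (inj₂ r)) (star⇒via rs)

  star? : Decidable R → Decidable (Star R)
  star? R? u v = map′ (via⇒star (allFin n)) star⇒via (via? R? (allFin n) u v)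

anyVec? : ∀ {m} {P : U.Pred (Vec (Fin n) m) 0ℓ} → U.Decidable P → Dec (∃ P)
anyVec? {m = zero}  P? = map′ (λ p → [] , p) (λ { ([] , p) → p }) (P? [])
anyVec? {m = suc m} P? =
  map′ (λ (x , xs , p) → x ∷ xs , p) (λ { (x ∷ xs , p) → x , xs , p })
       (Fin.any? λ x → anyVec? λ xs → P? (x ∷ xs))

isCycle? : {R : Rel (Fin n) 0ℓ} → Decidable R → ∀ {m} (c : Vec (Fin n) m) → Dec (IsCycle R c)
isCycle? R? {m} c =
  map′ (λ (p , q , r) → record { long = p ; distinct = q _ _ ; closed = r })
       (λ p → let open IsCycle p in long , (λ _ _ → distinct) , closed)
       (3 ≤? m
        ×-dec Fin.all? (λ i → Fin.all? λ j → (lookup c i Fin.≟ lookup c j) →-dec (i Fin.≟ j))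
        ×-dec Fin.all? (λ i → Fin.all? λ j →
          cycleEdge? m (toℕ i) (toℕ j) →-dec R? (lookup c i) (lookup c j)))

acyclic? : {R : Rel (Fin n) 0ℓ} → Decidable R → Dec (Acyclic R)
acyclic? {n} R? = ¬? (map′
  (λ (m , _ , c , p) → cycle c p)
  (λ (cycle {m} c p) → m , s≤s (Fin.injective⇒≤ (IsCycle.distinct p)) , c , p)
  (anyUpTo? (λ m → anyVec? {m = m} (isCycle? R?)) (suc n)))

isSubgraph? : (G : Graph n) → U.Decidable (IsSubgraph G)
isSubgraph? G H =
  map′ (λ (p , q , r) → record { symmetric = p ; endpoints = q ; adjacent = r })
       (λ p → let open IsSubgraph p in symmetric , endpoints , adjacent)
       (Fin.all? (λ u → Fin.all? λ v → edge? H u v →-dec edge? H v u)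
        ×-dec Fin.all? (λ u → Fin.all? λ v →
          edge? H u v →-dec (u ∈? vertices H ×-dec v ∈? vertices H))
        ×-dec Fin.all? (λ u → Fin.all? λ v → edge? H u v →-dec adj? G u v))

isTree? : U.Decidable (IsTree {n})
isTree? H =
  map′ (λ (p , q , r) → record { nonempty = p ; connected = q ; acyclic = r })
       (λ p → let open IsTree p in nonempty , connected , acyclic)
       (nonempty? (vertices H)
        ×-dec Fin.all? (λ u → Fin.all? λ v →
          (u ∈? vertices H) →-dec ((v ∈? vertices H) →-dec star? (edge? H) u v))
        ×-dec acyclic? (edge? H))

isSubtree? : (G : Graph n) (k : ℕ) → U.Decidable (IsSubtree G k)
isSubtree? G k H =
  map′ (λ (p , q , r) → record { isSubgraph = p ; isTree = q ; size = r })
       (λ p → let open IsSubtree p in isSubgraph , isTree , size)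
       (isSubgraph? G H ×-dec isTree? H ×-dec (∣ vertices H ∣ ≟ k))

------------------------------------------------------------------------
-- Counting subtrees

allVecs : ∀ {A : Set} → List A → (m : ℕ) → List (Vec A m)
allVecs xs zero    = [] ∷ []
allVecs xs (suc m) = cartesianProductWith _∷_ xs (allVecs xs m)

allSubsets : (n : ℕ) → List (Subset n)
allSubsets = allVecs (true ∷ false ∷ [])

allVertexEdgeSets : (n : ℕ) → List (VertexEdgeSets n)
allVertexEdgeSets n = cartesianProductWith ⟨_,_⟩ (allSubsets n) (allVecs (allSubsets n) n)

-- n_k(G); the value at k = 0 is a convention.

numSubtrees : Graph n → ℕ → ℕ
numSubtrees     G zero      = 1
numSubtrees {n} G k@(suc _) = List.length (filter (isSubtree? G k) (allVertexEdgeSets n))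

{-# OPTIONS --safe #-}

-- An n-vertex unicyclic graph of girth l is obtained from its cycle by n - l
-- times adding a vertex v with exactly one neighbour w among the earlier
-- vertices: a second neighbour would close a second cycle.  Write T(W,k) for the
-- number of k-vertex subtrees within the vertex set W and R(W,r,k) for those
-- that contain r.  Removing the leaf v gives, for k ≥ 1,
--
--   T(W ∪ v, k + 1) = T(W, k + 1) + R(W, w, k),  R(W ∪ v, v, k + 1) = R(W, w, k),
--   R(W, r, k + 1) ≤ R(W ∪ v, r, k + 1) ≤ R(W, r, k + 1) + R(W, r, k)  for r ∈ W.
--
-- For US, with r the centre, the last upper bound is attained at every step,
-- so US maximises R and hence T.  For UP, with r the end of the path, R obeys the
-- middle recurrence; since its values do not decrease with k as long as k does not
-- exceed the number of vertices, and since a spanning tree contains every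
-- vertex, they are a lower bound for R in any unicyclic graph.  The induction
-- starts at the cycle, where T = l and R = k for 1 ≤ k ≤ l.

module Submission where

open import Defs
open import Data.Nat using (ℕ; _≤_; _≥_)
open import Data.Product using (_×_)
open import Relation.Binary.PropositionalEquality using (_≡_)

open import Data.Bool.Base using (true; false)
open import Data.Empty using (⊥; ⊥-elim)
open import Data.Fin.Base using (Fin; zero; suc; toℕ; fromℕ; fromℕ<; inject₁; inject≤)
import Data.Fin.Properties as Fin
open import Data.Fin.Subset using (Subset; _∈_; _∉_; _⊆_; ∣_∣; ⊤; ⁅_⁆; inside; outside)
open import Data.Fin.Subset.Properties
  using (_∈?_; nonempty?; Empty-unique; ⊆-antisym; x∈⁅x⁆; x∈⁅y⁆⇒x≡y; ∈⊤;
         ∣⁅x⁆∣≡1; ∣⊥∣≡0; ∣⊤∣≡n; p⊆q⇒∣p∣≤∣q∣; p⊂q⇒∣p∣<∣q∣; ∣p∣≡n⇒p≡⊤)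
open import Data.List.Base as List using (List; []; _∷_; _++_; length; map; filter; applyUpTo)
import Data.List.Properties as List
import Data.List.Membership.Propositional as List∈
open import Data.List.Membership.Propositional.Properties
  using (∈-cartesianProductWith⁺; ∈-filter⁺; ∈-lookup; ∈-applyUpTo⁺)
open import Data.List.Relation.Unary.All as All using (All; []; _∷_)
import Data.List.Relation.Unary.All.Properties as All
open import Data.List.Relation.Unary.AllPairs using ([]; _∷_)
open import Data.List.Relation.Unary.Any as Any using (here; there)
open import Data.List.Relation.Unary.Any.Properties using (lookup-index)
open import Data.List.Relation.Unary.Unique.Propositional using (Unique)
import Data.List.Relation.Unary.Unique.Propositional.Properties as Unique
open import Data.Nat.Base using (zero; suc; _+_; _*_; _∸_; _<_; z≤n; s≤s; s≤s⁻¹; NonZero; >-nonZero)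
open import Data.Nat.DivMod using (_%_; _/_; m%n<n; n%n≡0; %-distribˡ-+; m≡m%n+[m/n]*n; [m+n]%n≡m%n; m<n⇒m%n≡m)
open import Data.Nat.Properties as ℕ using (_≤?_; _<?_; module ≤-Reasoning)
open import Data.Product.Base using (∃; ∃₂; _,_; proj₁; proj₂; swap)
open import Data.Sum.Base as Sum using (_⊎_; inj₁; inj₂; [_,_]′)
open import Data.Vec.Base as VecBase using (Vec; []; _∷_; lookup; tabulate; _[_]≔_)
import Data.Vec.Properties as Vec
open import Function.Base using (id; _∘_)
open import Function.Bundles using (Equivalence)
open import Function.Definitions using (Injective)
open import Level using (0ℓ)
open import Relation.Binary.Construct.Closure.ReflexiveTransitive as Star using (Star; ε; _◅_; _◅◅_)
open import Relation.Binary.Core using (Rel)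
open import Relation.Binary.Definitions using (Decidable; Symmetric; tri<; tri≈; tri>)
open import Relation.Binary.PropositionalEquality
  using (_≢_; refl; sym; trans; cong; cong₂; subst; subst₂; ≢-sym; module ≡-Reasoning)
open import Relation.Nullary.Decidable using (yes; no; does; decidable-stable; ¬?; _×-dec_; _⊎-dec_; dec-true)
open import Relation.Nullary.Negation using (¬_; contradiction)
open import Relation.Unary using (Pred)
import Relation.Unary as U

private
  variable
    n : ℕ

-- Counting by lists without repetition

module _ {A : Set} where

  -- Counting through repetition-free lists needs no enumeration of `P`. Such bounds pass along
  -- injective maps and disjoint splits, and turn into bounds on `numSubtrees` only at the end.
  AtMost : Pred A 0ℓ → ℕ → Set
  AtMost P N = ∀ xs → Unique xs → All P xs → length xs ≤ N

  AtLeast : Pred A 0ℓ → ℕ → Set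
  AtLeast P N = ∃ λ xs → Unique xs × All P xs × N ≤ length xs

  AtMost-mono : ∀ {P Q : Pred A 0ℓ} {M N} → P U.⊆ Q → M ≤ N → AtMost Q M → AtMost P N
  AtMost-mono P⊆Q M≤N b xs u a = ℕ.≤-trans (b xs u (All.map P⊆Q a)) M≤N

  AtLeast-mono : ∀ {P Q : Pred A 0ℓ} {M N} → P U.⊆ Q → N ≤ M → AtLeast P M → AtLeast Q N
  AtLeast-mono P⊆Q N≤M (xs , u , a , M≤) = xs , u , All.map P⊆Q a , ℕ.≤-trans N≤M M≤

  AtLeast-zero : ∀ {P : Pred A 0ℓ} → AtLeast P 0
  AtLeast-zero = [] , [] , [] , z≤n

  AtLeast-one : ∀ {P : Pred A 0ℓ} x → P x → AtLeast P 1
  AtLeast-one x p = x ∷ [] , [] ∷ [] , p ∷ [] , s≤s z≤n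

  AtMost-zero : ∀ {P : Pred A 0ℓ} → (∀ x → ¬ P x) → AtMost P 0
  AtMost-zero ¬P []       u a       = z≤n
  AtMost-zero ¬P (x ∷ xs) u (p ∷ _) = contradiction p (¬P x)

  AtMost-one : ∀ {P : Pred A 0ℓ} → (∀ {x y} → P x → P y → x ≡ y) → AtMost P 1
  AtMost-one !P []           u a = z≤n
  AtMost-one !P (x ∷ [])     u a = s≤s z≤n
  AtMost-one !P (x ∷ y ∷ xs) ((x≢y ∷ _) ∷ _) (p ∷ q ∷ _) = contradiction (!P p q) x≢y

  length-filter-¬ : ∀ {D : Pred A 0ℓ} (D? : U.Decidable D) xs →
    length (filter D? xs) + length (filter (¬? ∘ D?) xs) ≡ length xs
  length-filter-¬ D? [] = refl
  length-filter-¬ D? (x ∷ xs) with D? x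
  ... | yes d = cong suc (length-filter-¬ D? xs)
  ... | no ¬d = trans (ℕ.+-suc _ _) (cong suc (length-filter-¬ D? xs))

  AtMost-split : ∀ {P D : Pred A 0ℓ} {M N} → U.Decidable D →
    AtMost (λ x → P x × D x) M → AtMost (λ x → P x × ¬ D x) N → AtMost P (M + N)
  AtMost-split D? b c xs u a = begin
    length xs                                                ≡⟨ length-filter-¬ D? xs ⟨
    length (filter D? xs) + length (filter (¬? ∘ D?) xs)
      ≤⟨ ℕ.+-mono-≤
           (b _ (Unique.filter⁺ D? u) (All.zip (All.filter⁺ D? a , All.all-filter D? xs)))
           (c _ (Unique.filter⁺ (¬? ∘ D?) u)
              (All.zip (All.filter⁺ (¬? ∘ D?) a , All.all-filter (¬? ∘ D?) xs))) ⟩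
    _ ∎
    where open ≤-Reasoning

  AtLeast-split : ∀ {P D : Pred A 0ℓ} {M N} →
    AtLeast (λ x → P x × D x) M → AtLeast (λ x → P x × ¬ D x) N → AtLeast P (M + N)
  AtLeast-split {P} {D} (xs , u , a , M≤) (ys , v , b , N≤) =
    xs ++ ys , Unique.++⁺ u v disjoint , All.++⁺ (All.map proj₁ a) (All.map proj₁ b) ,
    subst (_ ≤_) (sym (List.length-++ xs)) (ℕ.+-mono-≤ M≤ N≤)
    where
    disjoint : ∀ {x} → ¬ (x List∈.∈ xs × x List∈.∈ ys)
    disjoint (x∈ , y∈) = proj₂ (All.lookup b y∈) (proj₂ (All.lookup a x∈))

  -- Pigeonhole: sending a position in `xs` to a position of the same element in `ys` is injective,
  -- since `xs` has no repetition.
  Unique-⊆⇒length≤ : ∀ {xs ys : List A} → Unique xs →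
    (∀ {x} → x List∈.∈ xs → x List∈.∈ ys) → length xs ≤ length ys
  Unique-⊆⇒length≤ {xs} {ys} u sub = Fin.injective⇒≤ {f = pos} pos-inj
    where
    pos : Fin (length xs) → Fin (length ys)
    pos i = Any.index (sub (∈-lookup {xs = xs} i))

    lookup-inj : ∀ {zs : List A} → Unique zs → ∀ {i j} → List.lookup zs i ≡ List.lookup zs j → i ≡ j
    lookup-inj (_ ∷ _) {zero}  {zero}  _ = refl
    lookup-inj {zs = _ ∷ zs} (z∉ ∷ _) {zero}  {suc j} e = contradiction e (All.lookup z∉ (∈-lookup {xs = zs} j))
    lookup-inj {zs = _ ∷ zs} (z∉ ∷ _) {suc i} {zero}  e = contradiction (sym e) (All.lookup z∉ (∈-lookup {xs = zs} i))
    lookup-inj (_ ∷ v) {suc i} {suc j} e = cong suc (lookup-inj v e)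

    pos-inj : Injective _≡_ _≡_ pos
    pos-inj {i} {j} e = lookup-inj u
      (trans (lookup-index (sub (∈-lookup {xs = xs} i)))
        (trans (cong (List.lookup ys) e) (sym (lookup-index (sub (∈-lookup {xs = xs} j))))))

  AtMost-cover : ∀ {P : Pred A 0ℓ} ys → (∀ {x} → P x → x List∈.∈ ys) → AtMost P (length ys)
  AtMost-cover ys cover xs u a = Unique-⊆⇒length≤ u (λ x∈ → cover (All.lookup a x∈))

module _ {A B : Set} where

  InjectiveOn : Pred A 0ℓ → (A → B) → Set
  InjectiveOn P f = ∀ {x y} → P x → P y → f x ≡ f y → x ≡ y

  Unique-map : ∀ {P : Pred A 0ℓ} {f : A → B} → InjectiveOn P f →
    ∀ {xs} → All P xs → Unique xs → Unique (map f xs)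
  Unique-map inj []       []       = []
  Unique-map inj (p ∷ ps) (x∉ ∷ u) =
    All.map⁺ (All.map (λ (q , x≢y) e → x≢y (inj p q e)) (All.zip (ps , x∉))) ∷ Unique-map inj ps u

  AtMost-map : ∀ {P : Pred A 0ℓ} {Q : Pred B 0ℓ} {N} (f : A → B) →
    (∀ {x} → P x → Q (f x)) → InjectiveOn P f → AtMost Q N → AtMost P N
  AtMost-map f P⇒Q inj b xs u a = subst (_≤ _) (List.length-map f xs)
    (b (map f xs) (Unique-map inj a u) (All.map⁺ (All.map P⇒Q a)))

  AtLeast-map : ∀ {P : Pred A 0ℓ} {Q : Pred B 0ℓ} {N} (f : A → B) →
    (∀ {x} → P x → Q (f x)) → InjectiveOn P f → AtLeast P N → AtLeast Q N
  AtLeast-map f P⇒Q inj (xs , u , a , N≤) =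
    map f xs , Unique-map inj a u , All.map⁺ (All.map P⇒Q a) ,
    subst (_ ≤_) (sym (List.length-map f xs)) N≤

-- Completeness of the enumeration behind `numSubtrees`

module _ {A : Set} {xs : List A} where

  allVecs-complete : (∀ x → x List∈.∈ xs) → ∀ {m} (v : Vec A m) → v List∈.∈ allVecs xs m
  allVecs-complete all []      = here refl
  allVecs-complete all (x ∷ v) = ∈-cartesianProductWith⁺ _∷_ (all x) (allVecs-complete all v)

  allVecs-unique : Unique xs → ∀ m → Unique (allVecs xs m)
  allVecs-unique u zero    = [] ∷ []
  allVecs-unique u (suc m) = Unique.cartesianProductWith⁺ _∷_ Vec.∷-injective u (allVecs-unique u m)

allSubsets-complete : ∀ {n} (p : Subset n) → p List∈.∈ allSubsets n
allSubsets-complete = allVecs-complete λ { true → here refl ; false → there (here refl) }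

allSubsets-unique : ∀ n → Unique (allSubsets n)
allSubsets-unique = allVecs-unique (((λ ()) ∷ []) ∷ [] ∷ [])

allVertexEdgeSets-complete : (H : VertexEdgeSets n) → H List∈.∈ allVertexEdgeSets n
allVertexEdgeSets-complete ⟨ V , E ⟩ =
  ∈-cartesianProductWith⁺ ⟨_,_⟩ (allSubsets-complete V) (allVecs-complete allSubsets-complete E)

allVertexEdgeSets-unique : ∀ n → Unique (allVertexEdgeSets n)
allVertexEdgeSets-unique n = Unique.cartesianProductWith⁺ ⟨_,_⟩ (λ { refl → refl , refl })
  (allSubsets-unique n) (allVecs-unique (allSubsets-unique n) n)

module _ (G : Graph n) (k : ℕ) where

  private
    subtrees : List (VertexEdgeSets n)
    subtrees = filter (isSubtree? G (suc k)) (allVertexEdgeSets n)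

  numSubtrees-≤ : ∀ {N} → AtMost (IsSubtree G (suc k)) N → numSubtrees G (suc k) ≤ N
  numSubtrees-≤ b = b subtrees (Unique.filter⁺ (isSubtree? G (suc k)) (allVertexEdgeSets-unique n))
    (All.all-filter (isSubtree? G (suc k)) (allVertexEdgeSets n))

  numSubtrees-≥ : ∀ {N} → AtLeast (IsSubtree G (suc k)) N → N ≤ numSubtrees G (suc k)
  numSubtrees-≥ (xs , u , a , N≤) = ℕ.≤-trans N≤ (Unique-⊆⇒length≤ u λ {H} H∈ →
    ∈-filter⁺ (isSubtree? G (suc k)) (allVertexEdgeSets-complete H) (All.lookup a H∈))

-- Vertex and edge sets

insert remove : Subset n → Fin n → Subset n
insert p x = p [ x ]≔ inside
remove p x = p [ x ]≔ outside

module _ {p : Subset n} {x : Fin n} where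

  x∈insert : x ∈ insert p x
  x∈insert = Vec.lookup⇒[]= x _ (Vec.lookup∘update x p inside)

  ∈-insert⁺ : p ⊆ insert p x
  ∈-insert⁺ {y} y∈p with y Fin.≟ x
  ... | yes refl = x∈insert
  ... | no y≢x   = Vec.lookup⇒[]= y _
    (trans (Vec.lookup∘update′ y≢x p inside) (Vec.[]=⇒lookup y∈p))

  ∈-insert⁻ : ∀ {y} → y ∈ insert p x → y ≡ x ⊎ y ∈ p
  ∈-insert⁻ {y} y∈ with y Fin.≟ x
  ... | yes y≡x = inj₁ y≡x
  ... | no y≢x  = inj₂ (Vec.lookup⇒[]= y p
    (trans (sym (Vec.lookup∘update′ y≢x p inside)) (Vec.[]=⇒lookup y∈)))

  x∉remove : x ∉ remove p x
  x∉remove x∈ with () ← trans (sym (Vec.lookup∘update x p outside)) (Vec.[]=⇒lookup x∈)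

  ∈-remove⁺ : ∀ {y} → y ∈ p → y ≢ x → y ∈ remove p x
  ∈-remove⁺ {y} y∈p y≢x = Vec.lookup⇒[]= y _
    (trans (Vec.lookup∘update′ y≢x p outside) (Vec.[]=⇒lookup y∈p))

  ∈-remove⁻ : ∀ {y} → y ∈ remove p x → y ∈ p × y ≢ x
  ∈-remove⁻ {y} y∈ with y Fin.≟ x
  ... | yes refl = contradiction y∈ x∉remove
  ... | no y≢x   = Vec.lookup⇒[]= y p
    (trans (sym (Vec.lookup∘update′ y≢x p outside)) (Vec.[]=⇒lookup y∈)) , y≢x

∣insert∣ : ∀ (p : Subset n) {x} → x ∉ p → ∣ insert p x ∣ ≡ suc ∣ p ∣
∣insert∣ (true  ∷ p) {zero}  x∉ = contradiction VecBase.here x∉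
∣insert∣ (false ∷ p) {zero}  x∉ = refl
∣insert∣ (true  ∷ p) {suc x} x∉ = cong suc (∣insert∣ p (x∉ ∘ VecBase.there))
∣insert∣ (false ∷ p) {suc x} x∉ = ∣insert∣ p (x∉ ∘ VecBase.there)

insert-remove : ∀ (p : Subset n) {x} → x ∈ p → insert (remove p x) x ≡ p
insert-remove p {x} x∈p = ⊆-antisym
  (λ y∈ → [ (λ { refl → x∈p }) , proj₁ ∘ ∈-remove⁻ ]′ (∈-insert⁻ y∈))
  (λ {y} → ⊇ y)
  where
  ⊇ : ∀ y → y ∈ p → y ∈ insert (remove p x) x
  ⊇ y y∈p with y Fin.≟ x
  ... | yes refl = x∈insert
  ... | no y≢x   = ∈-insert⁺ (∈-remove⁺ y∈p y≢x)

∣remove∣ : ∀ (p : Subset n) {x} → x ∈ p → suc ∣ remove p x ∣ ≡ ∣ p ∣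
∣remove∣ p {x} x∈p = trans (sym (∣insert∣ (remove p x) x∉remove)) (cong ∣_∣ (insert-remove p x∈p))

∣p∣≡1⇒singleton : ∀ {p : Subset n} {x y} → ∣ p ∣ ≡ 1 → x ∈ p → y ∈ p → y ≡ x
∣p∣≡1⇒singleton {p = p} {x} {y} ∣p∣≡1 x∈p y∈p with y Fin.≟ x
... | yes y≡x = y≡x
... | no y≢x with () ←
      trans (∣remove∣ (remove p x) (∈-remove⁺ y∈p y≢x)) (ℕ.suc-injective (trans (∣remove∣ p x∈p) ∣p∣≡1))

other-element : ∀ (p : Subset n) {x k} → x ∈ p → ∣ p ∣ ≡ suc (suc k) → ∃ λ y → y ∈ p × y ≢ x
other-element {n} p {x} x∈p size with nonempty? (remove p x)
... | yes (y , y∈) = y , ∈-remove⁻ y∈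
... | no empty with () ← trans (sym (trans (cong ∣_∣ (Empty-unique empty)) (∣⊥∣≡0 n)))
      (ℕ.suc-injective (trans (∣remove∣ p x∈p) size))

module _ (V : Subset n) {R : Rel (Fin n) 0ℓ} (R? : Decidable R) where

  withEdges : VertexEdgeSets n
  withEdges = ⟨ V , tabulate (λ x → tabulate (λ y → does (R? x y))) ⟩

  private
    entry : ∀ x y → lookup (lookup (edges withEdges) x) y ≡ does (R? x y)
    entry x y = trans (cong (λ r → lookup r y) (Vec.lookup∘tabulate _ x)) (Vec.lookup∘tabulate _ y)

  withEdges⁺ : ∀ {x y} → R x y → Edge withEdges x y
  withEdges⁺ {x} {y} r = Vec.lookup⇒[]= y _ (trans (entry x y) (dec-true (R? x y) r))

  withEdges⁻ : ∀ {x y} → Edge withEdges x y → R x y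
  withEdges⁻ {x} {y} e with R? x y | trans (sym (entry x y)) (Vec.[]=⇒lookup e)
  ... | yes r | _ = r

VertexEdgeSets-ext : {H K : VertexEdgeSets n} → vertices H ⊆ vertices K → vertices K ⊆ vertices H →
  (∀ {x y} → Edge H x y → Edge K x y) → (∀ {x y} → Edge K x y → Edge H x y) → H ≡ K
VertexEdgeSets-ext {H = ⟨ V , E ⟩} {K = ⟨ V′ , E′ ⟩} V⊆ V⊇ E⊆ E⊇ = cong₂ ⟨_,_⟩ (⊆-antisym V⊆ V⊇)
  (trans (sym (Vec.tabulate∘lookup E))
    (trans (Vec.tabulate-cong (λ x → ⊆-antisym E⊆ E⊇)) (Vec.tabulate∘lookup E′)))

-- Attaching and deleting a leaf

LeafEdge : Fin n → Fin n → Rel (Fin n) 0ℓ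
LeafEdge v w x y = (x ≡ v × y ≡ w) ⊎ (x ≡ w × y ≡ v)

leafSwap : ∀ {v w x y : Fin n} → LeafEdge v w x y → LeafEdge v w y x
leafSwap (inj₁ (p , q)) = inj₂ (q , p)
leafSwap (inj₂ (p , q)) = inj₁ (q , p)

module _ (H : VertexEdgeSets n) (v w : Fin n) where

  private
    R? : Decidable (λ x y → Edge H x y ⊎ LeafEdge v w x y)
    R? x y = edge? H x y ⊎-dec ((x Fin.≟ v ×-dec y Fin.≟ w) ⊎-dec (x Fin.≟ w ×-dec y Fin.≟ v))

  addLeaf : VertexEdgeSets n
  addLeaf = withEdges (insert (vertices H) v) R?

  addLeaf⁺ : ∀ {x y} → Edge H x y ⊎ LeafEdge v w x y → Edge addLeaf x y
  addLeaf⁺ = withEdges⁺ (insert (vertices H) v) R?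

  addLeaf⁻ : ∀ {x y} → Edge addLeaf x y → Edge H x y ⊎ LeafEdge v w x y
  addLeaf⁻ = withEdges⁻ (insert (vertices H) v) R?

module _ (H : VertexEdgeSets n) (v : Fin n) where

  private
    R? : Decidable (λ x y → Edge H x y × x ≢ v × y ≢ v)
    R? x y = edge? H x y ×-dec (¬? (x Fin.≟ v) ×-dec ¬? (y Fin.≟ v))

  removeVertex : VertexEdgeSets n
  removeVertex = withEdges (remove (vertices H) v) R?

  removeVertex⁺ : ∀ {x y} → Edge H x y → x ≢ v → y ≢ v → Edge removeVertex x y
  removeVertex⁺ e x≢v y≢v = withEdges⁺ (remove (vertices H) v) R? (e , x≢v , y≢v)

  removeVertex⁻ : ∀ {x y} → Edge removeVertex x y → Edge H x y × x ≢ v × y ≢ v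
  removeVertex⁻ = withEdges⁻ (remove (vertices H) v) R?

single : Fin n → VertexEdgeSets n
single v = withEdges ⁅ v ⁆ {R = λ _ _ → ⊥} (λ _ _ → no λ ())

single-noEdge : ∀ (v : Fin n) {x y} → ¬ Edge (single v) x y
single-noEdge v = withEdges⁻ ⁅ v ⁆ {R = λ _ _ → ⊥} (λ _ _ → no λ ())

-- Cycles and leaves

-- For `m = 2` the predecessor and the successor would coincide; `3 ≤ m` is what gives `h ≢ j`.
cycle-neighbours : ∀ {m} → 3 ≤ m → (i : Fin m) → ∃₂ λ (h j : Fin m) →
  CycleEdge m (toℕ h) (toℕ i) × CycleEdge m (toℕ i) (toℕ j) × h ≢ j
cycle-neighbours (s≤s (s≤s (s≤s {n = m} z≤n))) zero =
  fromℕ (2 + m) , suc zero ,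
  inj₂ (cong suc (Fin.toℕ-fromℕ (2 + m)) , refl) , inj₁ (refl , s≤s (s≤s z≤n)) , λ ()
cycle-neighbours {suc m} 3≤m (suc i) with suc (suc (toℕ i)) <? suc m
... | yes lt =
  h , fromℕ< lt ,
  inj₁ (cong suc (Fin.toℕ-inject₁ i) , Fin.toℕ<n (suc i)) ,
  inj₁ (sym (Fin.toℕ-fromℕ< lt) , subst (_< suc m) (sym (Fin.toℕ-fromℕ< lt)) lt) ,
  λ e → ℕ.<⇒≢ (s≤s (ℕ.n≤1+n (toℕ i)))
    (trans (sym (Fin.toℕ-inject₁ i)) (trans (cong toℕ e) (Fin.toℕ-fromℕ< lt)))
  where h = inject₁ i
... | no ≮ =
  h , zero ,
  inj₁ (cong suc (Fin.toℕ-inject₁ i) , Fin.toℕ<n (suc i)) ,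
  inj₂ (last , refl) ,
  λ e → ℕ.<⇒≢ (s≤s⁻¹ (s≤s⁻¹ (subst (3 ≤_) (sym last) 3≤m)))
    (sym (trans (sym (Fin.toℕ-inject₁ i)) (cong toℕ e)))
  where
  h = inject₁ i
  last : suc (suc (toℕ i)) ≡ suc m
  last = ℕ.≤-antisym (s≤s (Fin.toℕ<n i)) (ℕ.≮⇒≥ ≮)

-- A vertex on a cycle has two distinct neighbours there, while every neighbour of `v` equals `w`.
leaf-not-on-cycle : ∀ {R : Rel (Fin n) 0ℓ} {v w} → (∀ {x} → R x v → x ≡ w) → (∀ {x} → R v x → x ≡ w) →
  ∀ {m} {c : Vec (Fin n) m} → IsCycle R c → ∀ i → lookup c i ≢ v
leaf-not-on-cycle in≡w out≡w isCycle i refl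
  with h , j , h→i , i→j , h≢j ← cycle-neighbours (IsCycle.long isCycle) i =
  h≢j (IsCycle.distinct isCycle
    (trans (in≡w (IsCycle.closed isCycle h i h→i)) (sym (out≡w (IsCycle.closed isCycle i j i→j)))))

module _ {G : Graph n} where

  single-subtree : ∀ v → IsSubtree G 1 (single v)
  single-subtree v = record
    { isSubgraph = record
      { symmetric = λ x y e → ⊥-elim (single-noEdge v {x} {y} e)
      ; endpoints = λ x y e → ⊥-elim (single-noEdge v {x} {y} e)
      ; adjacent  = λ x y e → ⊥-elim (single-noEdge v {x} {y} e)
      }
    ; isTree = record
      { nonempty  = v , x∈⁅x⁆ v
      ; connected = λ x y x∈ y∈ → subst₂ (Star (Edge (single v)))
          (sym (x∈⁅y⁆⇒x≡y v x∈)) (sym (x∈⁅y⁆⇒x≡y v y∈)) ε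
      ; acyclic   = λ (cycle c isCycle) →
          let i = fromℕ< (ℕ.≤-trans (s≤s z≤n) (IsCycle.long isCycle))
              _ , j , _ , i→j , _ = cycle-neighbours (IsCycle.long isCycle) i
          in single-noEdge v {lookup c i} (IsCycle.closed isCycle i j i→j)
      }
    ; size = ∣⁅x⁆∣≡1 v
    }

  -- All vertices are reachable from `w`. No cycle can pass through the leaf, so a cycle in the
  -- larger graph would already lie in `H`.
  addLeaf-subtree : ∀ {k H v w} → IsSubtree G k H → v ∉ vertices H → w ∈ vertices H → Adj G v w →
    IsSubtree G (suc k) (addLeaf H v w)
  addLeaf-subtree {k} {H} {v} {w} T v∉ w∈ v~w = record
    { isSubgraph = record
      { symmetric = λ x y → addLeaf⁺ H v w ∘ Sum.map (symmetric x y) leafSwap ∘ addLeaf⁻ H v w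
      ; endpoints = λ x y e → ends (addLeaf⁻ H v w e)
      ; adjacent  = λ x y e → adj (addLeaf⁻ H v w e)
      }
    ; isTree = record
      { nonempty  = v , x∈insert
      ; connected = λ x y x∈ y∈ → Star.reverse sym′ (fromW (∈-insert⁻ x∈)) ◅◅ fromW (∈-insert⁻ y∈)
      ; acyclic   = λ (cycle c isCycle) → acyclic (cycle c record
          { long     = IsCycle.long isCycle
          ; distinct = IsCycle.distinct isCycle
          ; closed   = λ i j i→j → [ id , (λ { (inj₁ (e , _)) → contradiction e (off isCycle i)
                                             ; (inj₂ (_ , e)) → contradiction e (off isCycle j) }) ]′
              (addLeaf⁻ H v w (IsCycle.closed isCycle i j i→j)) })
      }
    ; size = trans (∣insert∣ (vertices H) v∉) (cong suc (IsSubtree.size T))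
    }
    where
    open IsSubtree T
    open IsSubgraph isSubgraph
    open IsTree isTree using (connected; acyclic)
    H′ = addLeaf H v w

    sym′ : Symmetric (Edge H′)
    sym′ = addLeaf⁺ H v w ∘ Sum.map (symmetric _ _) leafSwap ∘ addLeaf⁻ H v w

    ends : ∀ {x y} → Edge H x y ⊎ LeafEdge v w x y → x ∈ vertices H′ × y ∈ vertices H′
    ends (inj₁ e) = let x∈ , y∈ = endpoints _ _ e in ∈-insert⁺ x∈ , ∈-insert⁺ y∈
    ends (inj₂ (inj₁ (refl , refl))) = x∈insert , ∈-insert⁺ w∈
    ends (inj₂ (inj₂ (refl , refl))) = ∈-insert⁺ w∈ , x∈insert

    adj : ∀ {x y} → Edge H x y ⊎ LeafEdge v w x y → Adj G x y
    adj (inj₁ e) = adjacent _ _ e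
    adj (inj₂ (inj₁ (refl , refl))) = v~w
    adj (inj₂ (inj₂ (refl , refl))) = Graph.sym G v~w

    fromW : ∀ {x} → x ≡ v ⊎ x ∈ vertices H → Star (Edge H′) w x
    fromW (inj₁ refl) = addLeaf⁺ H v w (inj₂ (inj₂ (refl , refl))) ◅ ε
    fromW (inj₂ x∈)   = Star.map (addLeaf⁺ H v w ∘ inj₁) (connected _ _ w∈ x∈)

    into : ∀ {x} → Edge H′ x v → x ≡ w
    into e with addLeaf⁻ H v w e
    ... | inj₁ e′                  = contradiction (proj₂ (endpoints _ _ e′)) v∉
    ... | inj₂ (inj₁ (x≡v , v≡w)) = trans x≡v v≡w
    ... | inj₂ (inj₂ (x≡w , _))   = x≡w

    off : ∀ {m} {c : Vec (Fin n) m} → IsCycle (Edge H′) c → ∀ i → lookup c i ≢ v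
    off = leaf-not-on-cycle into (into ∘ sym′)

  removeVertex-subtree : ∀ {k H v w} → IsSubtree G (suc k) H → v ∈ vertices H → w ∈ vertices H → v ≢ w →
    (∀ {x} → Edge H v x → x ≡ w) → IsSubtree G k (removeVertex H v)
  removeVertex-subtree {k} {H} {v} {w} T v∈ w∈ v≢w out = record
    { isSubgraph = record
      { symmetric = λ x y e → let e′ , x≢v , y≢v = removeVertex⁻ H v e in removeVertex⁺ H v (symmetric x y e′) y≢v x≢v
      ; endpoints = λ x y e → let e′ , x≢v , y≢v = removeVertex⁻ H v e
                                  x∈ , y∈ = endpoints x y e′
                              in ∈-remove⁺ x∈ x≢v , ∈-remove⁺ y∈ y≢v
      ; adjacent  = λ x y e → adjacent x y (proj₁ (removeVertex⁻ H v e))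
      }
    ; isTree = record
      { nonempty  = w , ∈-remove⁺ w∈ (≢-sym v≢w)
      ; connected = λ x y x∈ y∈ →
          let x∈H , x≢v = ∈-remove⁻ x∈
              y∈H , y≢v = ∈-remove⁻ y∈
          in proj₁ (bypass y≢v (connected x y x∈H y∈H)) x≢v
      ; acyclic   = λ (cycle c isCycle) → acyclic (cycle c record
          { long     = IsCycle.long isCycle
          ; distinct = IsCycle.distinct isCycle
          ; closed   = λ i j → proj₁ ∘ removeVertex⁻ H v ∘ IsCycle.closed isCycle i j })
      }
    ; size = ℕ.suc-injective (trans (∣remove∣ (vertices H) v∈) size)
    }
    where
    open IsSubtree T
    open IsSubgraph isSubgraph
    open IsTree isTree using (connected; acyclic)
    H′ = removeVertex H v

    -- A walk visiting v enters and leaves it through w.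
    bypass : ∀ {x y} → y ≢ v → Star (Edge H) x y → (x ≢ v → Star (Edge H′) x y) × (x ≡ v → Star (Edge H′) w y)
    bypass y≢v ε = (λ _ → ε) , (λ y≡v → contradiction y≡v y≢v)
    bypass {x} y≢v (_◅_ {j = z} e es) with z Fin.≟ v | bypass y≢v es
    ... | yes refl | _ , viaW = (λ x≢v → subst (λ u → Star (Edge H′) u _) (sym (out (symmetric _ _ e))) (viaW refl)) ,
                                (λ { refl → viaW refl })
    ... | no z≢v | direct , _ = (λ x≢v → removeVertex⁺ H v e x≢v z≢v ◅ direct z≢v) ,
                                (λ { refl → subst (λ u → Star (Edge H′) u _) (out e) (direct z≢v) })

-- Growing the host graph by a pendent vertex

module _ (G : Graph n) where

  Subtrees : Pred (Fin n) 0ℓ → ℕ → Pred (VertexEdgeSets n) 0ℓ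
  Subtrees W k H = IsSubtree G k H × (∀ x → x ∈ vertices H → W x)

  Rooted : Pred (Fin n) 0ℓ → Fin n → ℕ → Pred (VertexEdgeSets n) 0ℓ
  Rooted W r k H = Subtrees W k H × r ∈ vertices H

  -- One growth step: `W′` is `W` together with `v`, whose only neighbour in `W` is `w`. Using
  -- predicates lets ring positions, label bounds and subsets all serve as vertex sets.
  record Pendent (W W′ : Pred (Fin n) 0ℓ) (v w : Fin n) : Set where
    field
      new    : W′ v
      old    : ∀ {x} → W x → W′ x
      cover  : ∀ {x} → W′ x → x ≡ v ⊎ W x
      fresh  : ¬ W v
      attach : W w
      edge   : Adj G v w
      only   : ∀ {x} → W x → Adj G v x → x ≡ w

  rooted-zero : ∀ {W r} H → ¬ Rooted W r 0 H
  rooted-zero H ((T , _) , r∈) with () ← trans (∣remove∣ (vertices H) r∈) (IsSubtree.size T)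

  rooted-one : ∀ {W r H K} → Rooted W r 1 H → Rooted W r 1 K → H ≡ K
  rooted-one {r = r} {H} {K} RH RK = VertexEdgeSets-ext
    (λ x∈ → subst (_∈ vertices K) (sym (is-r RH x∈)) (proj₂ RK))
    (λ x∈ → subst (_∈ vertices H) (sym (is-r RK x∈)) (proj₂ RH))
    (⊥-elim ∘ noEdge RH) (⊥-elim ∘ noEdge RK)
    where
    is-r : ∀ {W H} → Rooted W r 1 H → ∀ {x} → x ∈ vertices H → x ≡ r
    is-r ((T , _) , r∈) = ∣p∣≡1⇒singleton (IsSubtree.size T) r∈

    noEdge : ∀ {W H} → Rooted W r 1 H → ∀ {x y} → ¬ Edge H x y
    noEdge {H = H} R@((T , _) , _) e =
      let open IsSubgraph (IsSubtree.isSubgraph T)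
          x∈ , y∈ = endpoints _ _ e
      in Graph.irrefl G (trans (is-r {H = H} R x∈) (sym (is-r {H = H} R y∈))) (adjacent _ _ e)

module _ {G : Graph n} {W W′ : Pred (Fin n) 0ℓ} {v w : Fin n} (P : Pendent G W W′ v w) where

  open Pendent P

  private
    _∋?_ : (x : Fin n) → U.Decidable (λ H → x ∈ vertices H)
    x ∋? H = x ∈? vertices H

    within : ∀ {k H} → Subtrees G W′ k H → v ∉ vertices H → Subtrees G W k H
    within {H = H} (T , ⊆W′) v∉ = T , λ x x∈ →
      [ (λ x≡v → contradiction (subst (_∈ vertices H) x≡v x∈) v∉) , id ]′ (cover (⊆W′ x x∈))

    leaf-edges : ∀ {k H} → Subtrees G W′ k H → ∀ {x} → Edge H v x → x ≡ w
    leaf-edges {H = H} (T , ⊆W′) {x} e =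
      [ (λ x≡v → contradiction v~x (Graph.irrefl G (sym x≡v))) , (λ Wx → only Wx v~x) ]′
        (cover (⊆W′ x (proj₂ (endpoints v x e))))
      where
      open IsSubgraph (IsSubtree.isSubgraph T)
      v~x : Adj G v x
      v~x = adjacent v x e

    first-step : ∀ {R : Rel (Fin n) 0ℓ} {x y} → Star R x y → y ≢ x → ∃ (R x)
    first-step ε        y≢x = contradiction refl y≢x
    first-step (r ◅ rs) y≢x = _ , r

    -- With at least two vertices, the tree contains a walk from `v` to another vertex, and its
    -- first edge can only lead to `w`.
    leaf-edge : ∀ {k H} → Rooted G W′ v (suc (suc k)) H → Edge H v w
    leaf-edge {H = H} (S@(T , _) , v∈) with other-element (vertices H) v∈ (IsSubtree.size T)
    ... | y , y∈ , y≢v with first-step (IsTree.connected (IsSubtree.isTree T) v y v∈ y∈) y≢v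
    ... | x , e = subst (Edge H v) (leaf-edges S e) e

    v≢w : v ≢ w
    v≢w v≡w = Graph.irrefl G v≡w edge

    w∈H : ∀ {k H} → Rooted G W′ v (suc (suc k)) H → w ∈ vertices H
    w∈H {H = H} R@((T , _) , _) =
      proj₂ (IsSubgraph.endpoints (IsSubtree.isSubgraph T) v w (leaf-edge {H = H} R))

    prune : ∀ {k H} → Rooted G W′ v (suc (suc k)) H → Rooted G W w (suc k) (removeVertex H v)
    prune {H = H} R@(S@(T , ⊆W′) , v∈) =
      within (removeVertex-subtree T v∈ (w∈H R) v≢w (leaf-edges S) , λ x → ⊆W′ x ∘ proj₁ ∘ ∈-remove⁻) x∉remove ,
      ∈-remove⁺ (w∈H R) (≢-sym v≢w)

    graft : ∀ {k H} → Rooted G W w k H → Rooted G W′ v (suc k) (addLeaf H v w)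
    graft ((T , ⊆W) , w∈) =
      (addLeaf-subtree T (fresh ∘ ⊆W v) w∈ edge , λ x → [ (λ { refl → new }) , old ∘ ⊆W x ]′ ∘ ∈-insert⁻) , x∈insert

    graft-prune : ∀ {k H} → Rooted G W′ v (suc (suc k)) H → addLeaf (removeVertex H v) v w ≡ H
    graft-prune {H = H} R@(S@(T , _) , v∈) = VertexEdgeSets-ext
      (λ {x} → subst (x ∈_) (insert-remove (vertices H) v∈))
      (λ {x} → subst (x ∈_) (sym (insert-remove (vertices H) v∈)))
      (λ {x} {y} → [ proj₁ ∘ removeVertex⁻ H v {x} , leaf {x} {y} ]′ ∘ addLeaf⁻ (removeVertex H v) v w {x})
      (λ {x} {y} → addLeaf⁺ (removeVertex H v) v w ∘ other x y)
      where
      open IsSubgraph (IsSubtree.isSubgraph T)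

      leaf : ∀ {x y} → LeafEdge v w x y → Edge H x y
      leaf (inj₁ (refl , refl)) = leaf-edge {H = H} R
      leaf (inj₂ (refl , refl)) = symmetric _ _ (leaf-edge {H = H} R)

      other : ∀ x y → Edge H x y → Edge (removeVertex H v) x y ⊎ LeafEdge v w x y
      other x y e with x Fin.≟ v | y Fin.≟ v
      ... | yes refl | _        = inj₂ (inj₁ (refl , leaf-edges S e))
      ... | no x≢v   | yes refl = inj₂ (inj₂ (leaf-edges S (symmetric _ _ e) , refl))
      ... | no x≢v   | no y≢v   = inj₁ (removeVertex⁺ H v e x≢v y≢v)

    prune-graft : ∀ {k H} → Rooted G W w k H → removeVertex (addLeaf H v w) v ≡ H
    prune-graft {H = H} ((T , ⊆W) , _) = VertexEdgeSets-ext
      (λ {x} x∈ → let x∈′ , x≢v = ∈-remove⁻ x∈ in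
        [ (λ x≡v → contradiction x≡v x≢v) , id ]′ (∈-insert⁻ x∈′))
      (λ {x} x∈ → ∈-remove⁺ (∈-insert⁺ x∈) (≢v x∈))
      (λ {x} {y} e → let e′ , x≢v , y≢v = removeVertex⁻ (addLeaf H v w) v {x} {y} e in
        [ id , [ (λ (x≡v , _) → contradiction x≡v x≢v) , (λ (_ , y≡v) → contradiction y≡v y≢v) ]′ ]′
          (addLeaf⁻ H v w {x} {y} e′))
      (λ {x} {y} e → let x∈ , y∈ = endpoints x y e in
        removeVertex⁺ (addLeaf H v w) v {x} {y} (addLeaf⁺ H v w (inj₁ e)) (≢v x∈) (≢v y∈))
      where
      open IsSubgraph (IsSubtree.isSubgraph T)
      ≢v : ∀ {x} → x ∈ vertices H → x ≢ v
      ≢v x∈ x≡v = fresh (subst W x≡v (⊆W _ x∈))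

    prune-injective : ∀ {k} → InjectiveOn (Rooted G W′ v (suc (suc k))) (λ H → removeVertex H v)
    prune-injective RH RK e =
      trans (sym (graft-prune RH)) (trans (cong (λ H → addLeaf H v w) e) (graft-prune RK))

    graft-injective : ∀ {k} → InjectiveOn (Rooted G W w k) (λ H → addLeaf H v w)
    graft-injective RH RK e =
      trans (sym (prune-graft RH)) (trans (cong (λ H → removeVertex H v) e) (prune-graft RK))

    x≢v : ∀ {x} → W x → x ≢ v
    x≢v Wx x≡v = fresh (subst W x≡v Wx)

  -- `removeVertex` is injective here because regrafting the leaf undoes it. The size is at least 2
  -- since the one-vertex tree at `v` does not contain `w`.
  leaf-rooted-≤ : ∀ {k N} → AtMost (Rooted G W w (suc k)) N → AtMost (Rooted G W′ v (suc (suc k))) N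
  leaf-rooted-≤ = AtMost-map (λ H → removeVertex H v) prune prune-injective

  leaf-rooted-≥ : ∀ {k N} → AtLeast (Rooted G W w k) N → AtLeast (Rooted G W′ v (suc k)) N
  leaf-rooted-≥ = AtLeast-map (λ H → addLeaf H v w) graft graft-injective

  leaf-rooted-one : AtLeast (Rooted G W′ v 1) 1
  leaf-rooted-one = AtLeast-one (single v)
    ((single-subtree v , λ x x∈ → subst W′ (sym (x∈⁅y⁆⇒x≡y v x∈)) new) , x∈⁅x⁆ v)

  -- A subtree through `r` either avoids `v`, or loses the leaf `v` and still contains `r`.
  old-rooted-≤ : ∀ {r k M N} → W r → AtMost (Rooted G W r (suc k)) M → AtMost (Rooted G W r k) N →
    AtMost (Rooted G W′ r (suc k)) (N + M)
  old-rooted-≤ {r} {k} {M} {N} Wr b c = AtMost-split (v ∋?_) (with-v k c)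
    (AtMost-mono (λ ((S , r∈) , v∉) → within S v∉ , r∈) ℕ.≤-refl b)
    where
    with-v : ∀ k → AtMost (Rooted G W r k) N →
      AtMost (λ H → Rooted G W′ r (suc k) H × v ∈ vertices H) N
    -- A one-vertex subtree cannot contain both `r` and `v`.
    with-v zero    _ = AtMost-mono id z≤n
      (AtMost-zero λ H (((T , _) , r∈) , v∈) →
        x≢v Wr (∣p∣≡1⇒singleton (IsSubtree.size T) v∈ r∈))
    with-v (suc k) = AtMost-map (λ H → removeVertex H v)
      (λ ((S , r∈) , v∈) → proj₁ (prune (S , v∈)) , ∈-remove⁺ r∈ (x≢v Wr))
      (λ ((SH , _) , v∈H) ((SK , _) , v∈K) → prune-injective (SH , v∈H) (SK , v∈K))

  old-rooted-≥ : ∀ {r k N} → AtLeast (Rooted G W r k) N → AtLeast (Rooted G W′ r k) N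
  old-rooted-≥ = AtLeast-mono (λ ((T , ⊆W) , r∈) → (T , λ x → old ∘ ⊆W x) , r∈) ℕ.≤-refl

  -- When the root is the attachment vertex itself, `v` can be grafted onto every rooted subtree, so
  -- the bound of `old-rooted-≤` is attained.
  attach-rooted-≥ : ∀ {k M N} → AtLeast (Rooted G W w (suc k)) M → AtLeast (Rooted G W w k) N →
    AtLeast (Rooted G W′ w (suc k)) (N + M)
  attach-rooted-≥ b c = AtLeast-split {D = λ H → v ∈ vertices H}
    (AtLeast-map (λ H → addLeaf H v w)
      (λ R@(_ , w∈) → let S , v∈ = graft R in (S , ∈-insert⁺ w∈) , v∈) graft-injective c)
    (AtLeast-mono (λ ((T , ⊆W) , w∈) → ((T , λ x → old ∘ ⊆W x) , w∈) , fresh ∘ ⊆W v) ℕ.≤-refl b)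

  subtrees-≤ : ∀ {k M N} → AtMost (Subtrees G W k) M → AtMost (Rooted G W′ v k) N →
    AtMost (Subtrees G W′ k) (N + M)
  subtrees-≤ b c = AtMost-split (v ∋?_) c (AtMost-mono (λ (S , v∉) → within S v∉) ℕ.≤-refl b)

  subtrees-≥ : ∀ {k M N} → AtLeast (Subtrees G W k) M → AtLeast (Rooted G W′ v k) N →
    AtLeast (Subtrees G W′ k) (N + M)
  subtrees-≥ b c = AtLeast-split {D = λ H → v ∈ vertices H} c
    (AtLeast-mono (λ (T , ⊆W) → (T , λ x → old ∘ ⊆W x) , fresh ∘ ⊆W v) ℕ.≤-refl b)

-- Subtrees of a cycle

-- A chordless cycle is kept as an l-periodic sequence indexed by ℕ, so that
-- moving the starting point is a shift of the index.

record Ring (G : Graph n) (l : ℕ) (f : ℕ → Fin n) : Set where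
  field
    long     : 3 ≤ l
    periodic : ∀ j → f (j + l) ≡ f j
    distinct : ∀ {i j} → i < j → j < i + l → f i ≢ f j
    adjacent : ∀ j → Adj G (f j) (f (suc j))
    induced  : ∀ i j → Adj G (f (suc i)) (f j) → f j ≡ f (suc (suc i)) ⊎ f j ≡ f i

rotate : ∀ {G : Graph n} {l f} s → Ring G l f → Ring G l (λ j → f (j + s))
rotate {l = l} {f} s ring = record
  { long     = long
  ; periodic = λ j → trans (cong f (+-swap j)) (periodic (j + s))
  ; distinct = λ {i} {j} i<j j<i+l → distinct (ℕ.+-monoˡ-< s i<j) (subst (j + s <_) (+-swap i) (ℕ.+-monoˡ-< s j<i+l))
  ; adjacent = λ j → adjacent (j + s)
  ; induced  = λ i j → induced (i + s) (j + s)
  }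
  where
  open Ring ring
  +-swap : ∀ j → j + l + s ≡ j + s + l
  +-swap j = trans (ℕ.+-assoc j l s) (trans (cong (j +_) (ℕ.+-comm l s)) (sym (ℕ.+-assoc j s l)))

-- arc f a m has m + 1 vertices: f a, …, f (a + m).

arc : (ℕ → Fin n) → ℕ → ℕ → VertexEdgeSets n
arc f a zero    = single (f a)
arc f a (suc m) = addLeaf (arc f a m) (f (a + suc m)) (f (a + m))

arc-cong : ∀ {f : ℕ → Fin n} {a b} → (∀ j → f (a + j) ≡ f (b + j)) → ∀ m → arc f a m ≡ arc f b m
arc-cong {f = f} {a} {b} eq zero =
  cong single (subst₂ (λ i j → f i ≡ f j) (ℕ.+-identityʳ a) (ℕ.+-identityʳ b) (eq 0))
arc-cong {f = f} {a} {b} eq (suc m) rewrite arc-cong {f = f} {a} {b} eq m | eq (suc m) | eq m = refl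

module _ (f : ℕ → Fin n) (a : ℕ) where

  ∈-arc⁺ : ∀ {m j} → j ≤ m → f (a + j) ∈ vertices (arc f a m)
  ∈-arc⁺ {zero} z≤n = subst (λ i → f i ∈ ⁅ f a ⁆) (sym (ℕ.+-identityʳ a)) (x∈⁅x⁆ (f a))
  ∈-arc⁺ {suc m} {j} j≤ with ℕ.m≤n⇒m<n∨m≡n j≤
  ... | inj₁ j<   = ∈-insert⁺ (∈-arc⁺ (s≤s⁻¹ j<))
  ... | inj₂ refl = x∈insert

  ∈-arc⁻ : ∀ m {x} → x ∈ vertices (arc f a m) → ∃ λ j → j ≤ m × x ≡ f (a + j)
  ∈-arc⁻ zero x∈ = 0 , z≤n , trans (x∈⁅y⁆⇒x≡y (f a) x∈) (cong f (sym (ℕ.+-identityʳ a)))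
  ∈-arc⁻ (suc m) x∈ with ∈-insert⁻ x∈
  ... | inj₁ x≡ = suc m , ℕ.≤-refl , x≡
  ... | inj₂ x∈′ = let j , j≤ , x≡ = ∈-arc⁻ m x∈′ in j , ℕ.m≤n⇒m≤1+n j≤ , x≡

  arcEdge⁺ : ∀ {m j x y} → j < m → LeafEdge (f (a + suc j)) (f (a + j)) x y → Edge (arc f a m) x y
  arcEdge⁺ {suc m} {j} j< e with ℕ.m≤n⇒m<n∨m≡n j<
  ... | inj₁ (s≤s j<m) = addLeaf⁺ (arc f a m) _ _ (inj₁ (arcEdge⁺ j<m e))
  ... | inj₂ refl      = addLeaf⁺ (arc f a m) _ _ (inj₂ e)

  arcEdge⁻ : ∀ m {x y} → Edge (arc f a m) x y → ∃ λ j → j < m × LeafEdge (f (a + suc j)) (f (a + j)) x y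
  arcEdge⁻ zero    {x} {y} e = contradiction e (single-noEdge (f a) {x} {y})
  arcEdge⁻ (suc m) {x} {y} e with addLeaf⁻ (arc f a m) (f (a + suc m)) (f (a + m)) {x} {y} e
  ... | inj₁ e′ = let j , j<m , le = arcEdge⁻ m e′ in j , ℕ.m≤n⇒m≤1+n j<m , le
  ... | inj₂ le = m , ℕ.≤-refl , le

OnRing : (ℕ → Fin n) → Pred (Fin n) 0ℓ
OnRing f x = ∃ λ j → f j ≡ x

module _ {G : Graph n} {l : ℕ} {f : ℕ → Fin n} (ring : Ring G l f) where

  open Ring ring

  private
    0<l : 0 < l
    0<l = ℕ.≤-trans (s≤s z≤n) long

  periodic-* : ∀ q i → f (i + q * l) ≡ f i
  periodic-* zero    i = cong f (ℕ.+-identityʳ i)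
  periodic-* (suc q) i = trans (cong f (trans (cong (i +_) (ℕ.+-comm l (q * l))) (sym (ℕ.+-assoc i (q * l) l))))
    (trans (periodic (i + q * l)) (periodic-* q i))

  -- One representative serves all offsets `t`, so the starting point of a whole arc can be reduced
  -- modulo `l`.
  reduce : ∀ j → ∃ λ i → i < l × (∀ t → f (j + t) ≡ f (i + t))
  reduce j = j % l , m%n<n j l , λ t → trans
    (cong f (begin-equality
      j + t                       ≡⟨ cong (_+ t) (m≡m%n+[m/n]*n j l) ⟩
      j % l + (j / l) * l + t     ≡⟨ ℕ.+-assoc (j % l) _ t ⟩
      j % l + ((j / l) * l + t)   ≡⟨ cong (j % l +_) (ℕ.+-comm _ t) ⟩
      j % l + (t + (j / l) * l)   ≡⟨ ℕ.+-assoc (j % l) t _ ⟨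
      j % l + t + (j / l) * l     ∎))
    (periodic-* (j / l) (j % l + t))
    where
    open ≤-Reasoning
    instance _ = >-nonZero 0<l

  -- Any `l` consecutive indices cover the ring. Moving the window by one step drops `f a`, which
  -- returns at the far end as `f (a + l)`.
  window : ∀ a j → ∃ λ i → i < l × f j ≡ f (a + i)
  window zero j = let i , i<l , eq = reduce j in
    i , i<l , subst₂ (λ s t → f s ≡ f t) (ℕ.+-identityʳ j) (ℕ.+-identityʳ i) (eq 0)
  window (suc a) j with window a j
  ... | suc i , i<l , eq = i , ℕ.<-trans ℕ.≤-refl i<l , trans eq (cong f (ℕ.+-suc a i))
  ... | zero  , _   , eq = l ∸ 1 , ℕ.≤-reflexive 1+[l∸1] , (begin
      f j                ≡⟨ eq ⟩
      f (a + 0)          ≡⟨ cong f (ℕ.+-identityʳ a) ⟩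
      f a                ≡⟨ periodic a ⟨
      f (a + l)          ≡⟨ cong (λ k → f (a + k)) 1+[l∸1] ⟨
      f (a + suc (l ∸ 1)) ≡⟨ cong f (ℕ.+-suc a (l ∸ 1)) ⟩
      f (suc a + (l ∸ 1)) ∎)
    where
    open ≡-Reasoning
    1+[l∸1] : suc (l ∸ 1) ≡ l
    1+[l∸1] = ℕ.m+[n∸m]≡n 0<l

  offset-injective : ∀ a {i j} → i < l → j < l → f (a + i) ≡ f (a + j) → i ≡ j
  offset-injective a {i} {j} i<l j<l eq with ℕ.<-cmp i j
  ... | tri≈ _ i≡j _ = i≡j
  ... | tri< i<j _ _ = contradiction eq
    (distinct (ℕ.+-monoʳ-< a i<j) (ℕ.≤-trans (ℕ.+-monoʳ-< a j<l) (ℕ.+-monoˡ-≤ l (ℕ.m≤m+n a i))))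
  ... | tri> _ _ j<i = contradiction (sym eq)
    (distinct (ℕ.+-monoʳ-< a j<i) (ℕ.≤-trans (ℕ.+-monoʳ-< a i<l) (ℕ.+-monoˡ-≤ l (ℕ.m≤m+n a j))))

  arc-subtree : ∀ a {m} → m < l → IsSubtree G (suc m) (arc f a m)
  arc-subtree a {zero}  m<l = single-subtree (f a)
  arc-subtree a {suc m} m<l = addLeaf-subtree (arc-subtree a (ℕ.<-trans ℕ.≤-refl m<l))
    (λ fm∈ → let j , j≤m , eq = ∈-arc⁻ f a m fm∈ in
      ℕ.<⇒≢ (s≤s j≤m) (sym (offset-injective a m<l (ℕ.<-trans (s≤s j≤m) m<l) eq)))
    (∈-arc⁺ f a ℕ.≤-refl)
    (Graph.sym G (subst (Adj G (f (a + m)) ∘ f) (sym (ℕ.+-suc a m)) (adjacent (a + m))))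

  -- Vertex sets alone do not separate arcs, as all arcs with `l` vertices share theirs. The edge
  -- that enters the later starting point lies in the arc from `a`, but not in the arc that starts
  -- there.
  arc-distinct : ∀ {m a b} → a < b → b < l → m < l → arc f a m ≢ arc f b m
  arc-distinct {m} {a} {suc b} a<1+b 1+b<l m<l eq =
    [ (λ (p , q) → case₁ p q) , (λ (p , q) → case₂ p q) ]′ (proj₂ (proj₂ gap))
    where
    start∈ : f (suc b) ∈ vertices (arc f a m)
    start∈ = subst (λ H → f (suc b) ∈ vertices H) (sym eq)
      (subst (λ i → f i ∈ vertices (arc f (suc b) m)) (ℕ.+-identityʳ (suc b)) (∈-arc⁺ f (suc b) {m} z≤n))

    d = b ∸ a

    a+d : a + d ≡ b
    a+d = ℕ.m+[n∸m]≡n (s≤s⁻¹ a<1+b)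

    1+d<l : suc d < l
    1+d<l = ℕ.≤-trans (s≤s (s≤s (ℕ.m∸n≤m b a))) 1+b<l

    d<m : d < m
    d<m = let j , j≤m , e = ∈-arc⁻ f a m start∈ in
      ℕ.≤-trans (ℕ.≤-reflexive (offset-injective a 1+d<l (ℕ.≤-trans (s≤s j≤m) m<l)
        (trans (cong f (trans (ℕ.+-suc a d) (cong suc a+d))) e))) j≤m

    gap : ∃ λ j → j < m × LeafEdge (f (suc b + suc j)) (f (suc b + j)) (f b) (f (suc b))
    gap = arcEdge⁻ f (suc b) m (subst (λ H → Edge H (f b) (f (suc b))) eq
      (arcEdge⁺ f a d<m (inj₂ (cong f (sym a+d) , cong f (sym (trans (ℕ.+-suc a d) (cong suc a+d)))))))

    j = proj₁ gap
    j<m = proj₁ (proj₂ gap)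

    at : ∀ i → suc b + i ≡ b + suc i
    at i = sym (ℕ.+-suc b i)

    b≡ : f b ≡ f (b + 0)
    b≡ = cong f (sym (ℕ.+-identityʳ b))

    case₂ : f b ≡ f (suc b + j) → f (suc b) ≡ f (suc b + suc j) → ⊥
    case₂ p _ with () ← offset-injective b 0<l (ℕ.≤-trans (s≤s j<m) m<l) (trans (sym b≡) (trans p (cong f (at j))))

    case₁ : f b ≡ f (suc b + suc j) → f (suc b) ≡ f (suc b + j) → ⊥
    -- This orientation forces `j = 0` and then `f b ≡ f (b + 2)`, which `3 ≤ l` excludes.
    case₁ p q with offset-injective (suc b) 0<l (ℕ.<-trans j<m m<l) (trans (cong f (ℕ.+-identityʳ (suc b))) q)
    ... | 0≡j with () ← offset-injective b {0} {2} 0<l long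
          (trans (sym b≡) (trans p (cong f (trans (at (suc j)) (cong (λ i → b + suc (suc i)) (sym 0≡j))))))

  -- If all `l` ring edges were in `H`, the ring itself would be a cycle of `H`.
  missing-edge : ∀ {H} → Acyclic (Edge H) → ∃ λ a → ¬ Edge H (f a) (f (suc a))
  missing-edge {H} acyclic with ℕ.anyUpTo? (λ a → ¬? (edge? H (f a) (f (suc a)))) l
  ... | yes (a , _ , ¬e) = a , ¬e
  ... | no  all = contradiction (cycle c isCycle) acyclic
    where
    c : Vec (Fin n) l
    c = tabulate (f ∘ toℕ)

    lookup-c : ∀ i → lookup c i ≡ f (toℕ i)
    lookup-c = Vec.lookup∘tabulate (f ∘ toℕ)

    present : ∀ {a} → a < l → Edge H (f a) (f (suc a))
    present {a} a<l = decidable-stable (edge? H (f a) (f (suc a))) (λ ¬e → all (a , a<l , ¬e))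

    isCycle : IsCycle (Edge H) c
    isCycle = record
      { long     = long
      ; distinct = λ {i} {j} eq → Fin.toℕ-injective (offset-injective 0 (Fin.toℕ<n i) (Fin.toℕ<n j)
          (trans (sym (lookup-c i)) (trans eq (lookup-c j))))
      ; closed   = λ i j i→j → subst₂ (Edge H) (sym (lookup-c i)) (sym (lookup-c j))
          (subst (Edge H (f (toℕ i))) (next i→j) (present (Fin.toℕ<n i)))
      }
      where
      next : ∀ {i j} → CycleEdge l i j → f (suc i) ≡ f j
      next (inj₁ (1+i≡j , _))     = cong f 1+i≡j
      next (inj₂ (1+i≡l , refl)) = trans (cong f 1+i≡l) (periodic 0)

  -- Every subtree of a cycle is an arc

  module _ {k : ℕ} {H : VertexEdgeSets n} (S : Subtrees G (OnRing f) (suc k) H) where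

    private
      open IsSubtree (proj₁ S) using (isSubgraph; isTree; size)
      open IsSubgraph isSubgraph using (symmetric; endpoints)
      open IsTree isTree using (nonempty; connected; acyclic)

      onRing : ∀ {x} → x ∈ vertices H → OnRing f x
      onRing = proj₂ S _

      Start : ℕ → Set
      Start a = ¬ Edge H (f a) (f (suc a)) × f (suc a) ∈ vertices H

      -- Moves forward from a missing edge to the first vertex of `H`: if the next vertex is not in
      -- `H`, the edge after it is missing too. `d` is the distance to a vertex known to be in `H`.
      seek-start : ∀ d a → ¬ Edge H (f a) (f (suc a)) → f (suc a + d) ∈ vertices H → ∃ Start
      seek-start zero    a ¬e fa∈ = a , ¬e , subst (λ i → f i ∈ vertices H) (ℕ.+-identityʳ (suc a)) fa∈
      seek-start (suc d) a ¬e fa∈ with f (suc a) ∈? vertices H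
      ... | yes ∈ = a , ¬e , ∈
      ... | no  ∉ = seek-start d (suc a) (∉ ∘ proj₁ ∘ endpoints _ _)
        (subst (λ i → f i ∈ vertices H) (ℕ.+-suc (suc a) d) fa∈)

      start : ∃ Start
      start =
        let a , ¬e       = missing-edge {H} acyclic
            x , x∈       = nonempty
            j , fj≡x     = onRing x∈
            d , _ , fj≡  = window (suc a) j
        in seek-start d a ¬e (subst (_∈ vertices H) (trans (sym fj≡x) fj≡) x∈)

      a b : ℕ
      a = proj₁ start
      b = suc a

      fb∈ : f b ∈ vertices H
      fb∈ = proj₂ (proj₂ start)

      ¬wrap : ¬ Edge H (f b) (f a)
      ¬wrap = proj₁ (proj₂ start) ∘ symmetric _ _

      -- The ring is chordless, so an edge of `H` changes the position by one. It cannot go back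
      -- from position 0, because the edge between `f b` and `f a` is missing.
      step : ∀ i {y} → Edge H (f (b + i)) y → y ≡ f (b + suc i) ⊎ (∃ λ i′ → i ≡ suc i′ × y ≡ f (b + i′))
      step i {y} e with onRing (proj₂ (endpoints _ _ e))
      ... | j , refl with induced (a + i) j (IsSubgraph.adjacent isSubgraph _ _ e)
      ... | inj₁ fj≡ = inj₁ (trans fj≡ (cong f (sym (ℕ.+-suc b i))))
      step zero {y} e | j , refl | inj₂ fj≡ =
        contradiction (subst₂ (Edge H) (cong f (ℕ.+-identityʳ b)) (trans fj≡ (cong f (ℕ.+-identityʳ a))) e) ¬wrap
      step (suc i) {y} e | j , refl | inj₂ fj≡ = inj₂ (i , refl , trans fj≡ (cong f (ℕ.+-suc a i)))

      -- Invariant of walks in `H` from `f b`: every ring edge between `f b` and the current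
      -- position belongs to `H`.
      Reached : Fin n → ℕ → Set
      Reached x i = i < l × x ≡ f (b + i) × (∀ {j} → j < i → Edge H (f (b + j)) (f (b + suc j)))

      reached-start : ∀ {x} → x ≡ f b → Reached x 0
      reached-start x≡ = 0<l , trans x≡ (cong f (sym (ℕ.+-identityʳ b))) , λ ()

      reached-step : ∀ {x y i} → Reached x i → Edge H x y → ∃ (Reached y)
      reached-step {i = i} (i<l , refl , below) e with step i e
      ... | inj₂ (i′ , refl , y≡) = i′ , ℕ.<-trans ℕ.≤-refl i<l , y≡ , below ∘ ℕ.m≤n⇒m≤1+n
      ... | inj₁ y≡ with ℕ.m≤n⇒m<n∨m≡n i<l
      -- A step forward from position `l - 1` lands on `f b`, and position 0 requires no edges.
      ... | inj₂ refl = 0 , reached-start (trans y≡ (periodic b))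
      ... | inj₁ 1+i<l = suc i , 1+i<l , y≡ , below′
        where
        below′ : ∀ {j} → j < suc i → Edge H (f (b + j)) (f (b + suc j))
        below′ j≤i with ℕ.m≤n⇒m<n∨m≡n (s≤s⁻¹ j≤i)
        ... | inj₁ j<i  = below j<i
        ... | inj₂ refl = subst (Edge H _) y≡ e

      reached-star : ∀ {x y i} → Reached x i → Star (Edge H) x y → ∃ (Reached y)
      reached-star r ε        = _ , r
      reached-star r (e ◅ es) = reached-star (proj₂ (reached-step r e)) es

      reached : ∀ {x} → x ∈ vertices H → ∃ (Reached x)
      reached x∈ = reached-star (reached-start refl) (connected _ _ fb∈ x∈)

      Run : ℕ → Set
      Run m = ∀ {j} → j ≤ m → f (b + j) ∈ vertices H

      -- Extends the run of vertices from `f b` until the next one is missing or all `l` positions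
      -- are used; `d` counts the remaining positions.
      seek-end : ∀ d m → suc m + d ≡ l → Run m →
        ∃ λ m → m < l × Run m × (suc m ≡ l ⊎ f (b + suc m) ∉ vertices H)
      seek-end zero    m 1+m≡l run =
        m , ℕ.≤-reflexive 1+m≡l′ , run , inj₁ 1+m≡l′
        where 1+m≡l′ = trans (sym (ℕ.+-identityʳ (suc m))) 1+m≡l
      seek-end (suc d) m 1+m+d≡l run with f (b + suc m) ∈? vertices H
      ... | no  ∉ = m , ℕ.≤-trans (ℕ.m≤m+n (suc m) (suc d)) (ℕ.≤-reflexive 1+m+d≡l) , run , inj₂ ∉
      ... | yes ∈ = seek-end d (suc m) (trans (sym (ℕ.+-suc (suc m) d)) 1+m+d≡l)
        (λ j≤ → [ run ∘ s≤s⁻¹ , (λ { refl → ∈ }) ]′ (ℕ.m≤n⇒m<n∨m≡n j≤))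

      end : ∃ λ m → m < l × Run m × (suc m ≡ l ⊎ f (b + suc m) ∉ vertices H)
      end = seek-end (l ∸ 1) 0 (ℕ.m+[n∸m]≡n 0<l)
        (λ { z≤n → subst (λ i → f i ∈ vertices H) (sym (ℕ.+-identityʳ b)) fb∈ })

      m = proj₁ end

      m<l : m < l
      m<l = proj₁ (proj₂ end)

      run : Run m
      run = proj₁ (proj₂ (proj₂ end))

      -- Reaching a position beyond `m` would use an edge into the vertex after the run, which is
      -- not in `H` unless the run already fills the ring.
      reached≤m : ∀ {x i} → Reached x i → i ≤ m
      reached≤m {i = i} (i<l , _ , below) = ℕ.≮⇒≥ λ m<i →
        [ (λ 1+m≡l → ℕ.<⇒≱ i<l (subst (_≤ i) 1+m≡l m<i))
        , contradiction (proj₂ (endpoints _ _ (below m<i))) ]′ (proj₂ (proj₂ (proj₂ end)))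

      H⊆arc : vertices H ⊆ vertices (arc f b m)
      H⊆arc x∈ = let i , r@(_ , x≡ , _) = reached x∈ in
        subst (_∈ vertices (arc f b m)) (sym x≡) (∈-arc⁺ f b (reached≤m r))

      arc⊆H : vertices (arc f b m) ⊆ vertices H
      arc⊆H x∈ = let j , j≤m , x≡ = ∈-arc⁻ f b m x∈ in subst (_∈ vertices H) (sym x≡) (run j≤m)

      edge⊆arc : ∀ {x y} → Edge H x y → Edge (arc f b m) x y
      edge⊆arc {x} {y} e with reached (proj₁ (endpoints _ _ e))
      ... | i , r@(_ , refl , _) with step i e
      ... | inj₂ (i′ , refl , y≡) = arcEdge⁺ f b (reached≤m r) (inj₁ (refl , y≡))
      ... | inj₁ y≡ with ℕ.m≤n⇒m<n∨m≡n (reached≤m r)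
      ... | inj₁ i<m  = arcEdge⁺ f b i<m (inj₂ (refl , y≡))
      ... | inj₂ refl with proj₂ (proj₂ (proj₂ end))
      ... | inj₂ ∉ = contradiction (subst (_∈ vertices H) y≡ (proj₂ (endpoints _ _ e))) ∉
      -- When the run fills the ring, the forward edge from its end would be the missing edge
      -- between `f a` and `f b`.
      ... | inj₁ 1+m≡l = contradiction
        (symmetric _ _ (subst₂ (Edge H) last (trans y≡ (trans (cong (λ i → f (b + i)) 1+m≡l) (periodic b))) e)) ¬wrap
        where
        last : f (b + m) ≡ f a
        last = trans (cong f (sym (ℕ.+-suc a m))) (trans (cong (λ i → f (a + i)) 1+m≡l) (periodic a))

      arc⊆edge : ∀ {x y} → Edge (arc f b m) x y → Edge H x y
      arc⊆edge e with arcEdge⁻ f b m e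
      ... | j , j<m , le = [ (λ { (refl , refl) → symmetric _ _ forward }) , (λ { (refl , refl) → forward }) ]′ le
        where
        forward : Edge H (f (b + j)) (f (b + suc j))
        forward =
          let i , i<l , eq , below = reached (run j<m)
          in below (ℕ.≤-reflexive (offset-injective b (ℕ.≤-trans (s≤s j<m) m<l) i<l eq))

      H≡arc : H ≡ arc f b m
      H≡arc = VertexEdgeSets-ext H⊆arc arc⊆H edge⊆arc (λ {x} {y} → arc⊆edge {x} {y})

      m≡k : m ≡ k
      m≡k = ℕ.suc-injective
        (trans (sym (IsSubtree.size (arc-subtree b m<l))) (trans (cong (∣_∣ ∘ vertices) (sym H≡arc)) size))

    subtree-is-arc : k < l × ∃ λ s → s < l × H ≡ arc f s k
    subtree-is-arc =
      let s , s<l , eq = reduce b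
      in subst (_< l) m≡k m<l , s , s<l ,
         trans H≡arc (trans (cong (arc f b) m≡k) (arc-cong {f = f} {b} {s} eq k))

-- For `1 ≤ k ≤ l`, `C_l` has `l` arcs with `k` vertices, and `k` of them pass through a given
-- vertex. Larger arcs do not exist.
cycleRooted cycleTotal : ℕ → ℕ → ℕ
cycleRooted l k with k ≤? l
... | yes _ = k
... | no  _ = 0
cycleTotal l k with k ≤? l
... | yes _ = l
... | no  _ = 0

cycleRooted-zero : ∀ l → cycleRooted l 0 ≡ 0
cycleRooted-zero l with 0 ≤? l
... | yes _ = refl
... | no  _ = refl

module _ {G : Graph n} {l : ℕ} where

  private
    arcs : (ℕ → Fin n) → ℕ → ℕ → List (VertexEdgeSets n)
    arcs f k = applyUpTo (λ a → arc f a k)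

    length-arcs : ∀ f k N → length (arcs f k N) ≡ N
    length-arcs f k N = List.length-applyUpTo (λ a → arc f a k) N

    arcs-subtrees : ∀ {f} (ring : Ring G l f) {k N} {P : Pred (VertexEdgeSets n) 0ℓ} → N ≤ l → k < l →
      (∀ {a} → a < N → P (arc f a k)) → AtLeast P N
    arcs-subtrees {f} ring {k} {N} N≤l k<l p =
      arcs f k N ,
      Unique.applyUpTo⁺₁ _ N (λ i<j j<N → arc-distinct ring i<j (ℕ.≤-trans j<N N≤l) k<l) ,
      All.applyUpTo⁺₁ _ N p ,
      ℕ.≤-reflexive (sym (length-arcs f k N))

    arc-on-ring : ∀ {f} (ring : Ring G l f) a {k} → k < l → Subtrees G (OnRing f) (suc k) (arc f a k)
    arc-on-ring {f} ring a {k} k<l = arc-subtree ring a k<l , λ x x∈ →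
      let j , _ , x≡ = ∈-arc⁻ f a k x∈ in a + j , sym x≡

    rooted-≤ : ∀ {f} → Ring G l f → ∀ k → AtMost (Rooted G (OnRing f) (f k) (suc k)) (cycleRooted l (suc k))
    rooted-≤ {f} ring k with suc k ≤? l
    ... | no  ≰   = AtMost-zero λ H (S , _) → ≰ (proj₁ (subtree-is-arc ring S))
    ... | yes k<l = subst (AtMost _) (length-arcs f k (suc k)) (AtMost-cover (arcs f k (suc k)) λ {H} → covered {H})
      where
      covered : ∀ {H} → Rooted G (OnRing f) (f k) (suc k) H → H List∈.∈ arcs f k (suc k)
      covered (S , r∈) with subtree-is-arc ring S
      ... | _ , s , s<l , refl with ∈-arc⁻ f s k r∈
      -- An arc with start `s` beyond `k` would meet the root again only at index `k + l`, while
      -- `s + j < l + k`.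
      ... | j , j≤k , eq = ∈-applyUpTo⁺ (λ a → arc f a k) (s≤s (ℕ.≮⇒≥ λ k<s →
        Ring.distinct ring (ℕ.≤-trans k<s (ℕ.m≤m+n s j))
          (ℕ.≤-trans (ℕ.+-mono-<-≤ s<l j≤k) (ℕ.≤-reflexive (ℕ.+-comm l k))) eq))

    rooted-≥ : ∀ {f} → Ring G l f → ∀ k → AtLeast (Rooted G (OnRing f) (f k) (suc k)) (cycleRooted l (suc k))
    rooted-≥ {f} ring k with suc k ≤? l
    ... | no  _   = AtLeast-zero
    ... | yes k<l = arcs-subtrees ring k<l k<l λ {a} a≤k → arc-on-ring ring a k<l ,
      subst (λ i → f i ∈ vertices (arc f a k)) (ℕ.m+[n∸m]≡n (s≤s⁻¹ a≤k)) (∈-arc⁺ f a (ℕ.m∸n≤m k a))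

  module _ {f : ℕ → Fin n} (ring : Ring G l f) where

    private
      -- Once the root is at position k, the arcs with k + 1 vertices through it are
      -- those that start at 0, …, k.
      place : ∀ {r} k → OnRing f r → ∃ λ s → r ≡ f (k + s)
      place k (i , fi≡r) = let s , _ , eq = window ring k i in s , trans (sym fi≡r) eq

      onRotated : ∀ s {x} → OnRing f x → OnRing (λ j → f (j + s)) x
      onRotated s (i , fi≡x) = let t , _ , eq = window ring s i in
        t , trans (cong f (ℕ.+-comm t s)) (trans (sym eq) fi≡x)

    cycle-rooted-≤ : ∀ {r} → OnRing f r → ∀ k → AtMost (Rooted G (OnRing f) r k) (cycleRooted l k)
    cycle-rooted-≤ r∈ zero = AtMost-mono id z≤n (AtMost-zero (rooted-zero G))
    cycle-rooted-≤ r∈ (suc k) with place k r∈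
    ... | s , refl = AtMost-mono (λ ((T , on) , r∈) → (T , λ x → onRotated s ∘ on x) , r∈)
      ℕ.≤-refl (rooted-≤ (rotate s ring) k)

    cycle-rooted-≥ : ∀ {r} → OnRing f r → ∀ k → AtLeast (Rooted G (OnRing f) r k) (cycleRooted l k)
    cycle-rooted-≥ r∈ zero = AtLeast-mono id (ℕ.≤-reflexive (cycleRooted-zero l)) AtLeast-zero
    cycle-rooted-≥ r∈ (suc k) with place k r∈
    ... | s , refl = AtLeast-mono (λ ((T , on) , r∈) → (T , λ x x∈ → let j , eq = on x x∈ in j + s , eq) , r∈)
      ℕ.≤-refl (rooted-≥ (rotate s ring) k)

    cycle-subtrees-≤ : ∀ k → AtMost (Subtrees G (OnRing f) (suc k)) (cycleTotal l (suc k))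
    cycle-subtrees-≤ k with suc k ≤? l
    ... | no  ≰   = AtMost-zero λ H S → ≰ (proj₁ (subtree-is-arc ring S))
    ... | yes k<l = subst (AtMost _) (length-arcs f k l) (AtMost-cover (arcs f k l) λ S →
      let _ , s , s<l , eq = subtree-is-arc ring S
      in subst (List∈._∈ arcs f k l) (sym eq) (∈-applyUpTo⁺ (λ a → arc f a k) s<l))

    cycle-subtrees-≥ : ∀ k → AtLeast (Subtrees G (OnRing f) (suc k)) (cycleTotal l (suc k))
    cycle-subtrees-≥ k with suc k ≤? l
    ... | no  _   = AtLeast-zero
    ... | yes k<l = arcs-subtrees ring ℕ.≤-refl k<l λ {a} _ → arc-on-ring ring a k<l

-- The counts for US and UP

cycleRooted-> : ∀ {l k} → l < k → cycleRooted l k ≡ 0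
cycleRooted-> {l} {k} l<k with k ≤? l
... | yes k≤l = contradiction k≤l (ℕ.<⇒≱ l<k)
... | no  _   = refl

cycleRooted-mono : ∀ {l k} → suc k ≤ l → cycleRooted l k ≤ cycleRooted l (suc k)
cycleRooted-mono {l} {k} k<l with suc k ≤? l | k ≤? l
... | no  ≰ | _     = contradiction k<l ≰
... | yes _ | yes _ = ℕ.n≤1+n k
... | yes _ | no  _ = z≤n

cycleRooted-one : ∀ {l} → 1 ≤ l → cycleRooted l 1 ≡ 1
cycleRooted-one {l} 1≤l with 1 ≤? l
... | yes _ = refl
... | no  ≰ = contradiction 1≤l ≰

-- If c counts the subtrees rooted at w, then extend c k counts those with k + 1
-- vertices rooted at a new leaf at w: removing the leaf leaves a subtree rooted
-- at w, or nothing when k = 0.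
extend : (ℕ → ℕ) → ℕ → ℕ
extend c zero    = 1
extend c (suc k) = c (suc k)

-- Counts after `s` vertices have been added to `C_l`: as pendent vertices at one centre, which is
-- the root, or as a path whose end is the root. They are the intermediate bounds between a general
-- graph and `US` or `UP`.
starRooted starTotal pathRooted pathTotal : (l s k : ℕ) → ℕ

starRooted l zero    k       = cycleRooted l k
starRooted l (suc s) zero    = 0
starRooted l (suc s) (suc k) = starRooted l s k + starRooted l s (suc k)

starTotal l zero    k       = cycleTotal l k
starTotal l (suc s) zero    = 0
starTotal l (suc s) (suc k) = extend (starRooted l s) k + starTotal l s (suc k)

pathRooted l zero    k       = cycleRooted l k
pathRooted l (suc s) zero    = 0
pathRooted l (suc s) (suc k) = extend (pathRooted l s) k

pathTotal l zero    k       = cycleTotal l k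
pathTotal l (suc s) zero    = 0
pathTotal l (suc s) (suc k) = extend (pathRooted l s) k + pathTotal l s (suc k)

module _ {l : ℕ} (1≤l : 1 ≤ l) where

  starRooted-one : ∀ s → 1 ≤ starRooted l s 1
  starRooted-one zero    = ℕ.≤-reflexive (sym (cycleRooted-one 1≤l))
  starRooted-one (suc s) = ℕ.≤-trans (starRooted-one s) (ℕ.m≤n+m _ (starRooted l s 0))

  -- Rooting at a new leaf gives no more than rooting at the centre of the star, so a leaf root
  -- never breaks the upper bound.
  starRooted-extend : ∀ s k → extend (starRooted l s) k ≤ starRooted l (suc s) (suc k)
  starRooted-extend s zero    = starRooted-one (suc s)
  starRooted-extend s (suc k) = ℕ.m≤m+n _ _

  pathRooted-> : ∀ s {k} → s + l < k → pathRooted l s k ≡ 0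
  pathRooted-> zero    l<k = cycleRooted-> l<k
  pathRooted-> (suc s) {suc zero} (s≤s ())
  pathRooted-> (suc s) {suc (suc k)} (s≤s s+l<k) = pathRooted-> s s+l<k

  -- From size 1 on, each new path vertex shifts the sequence by one place and puts a 1 in front;
  -- monotonicity survives because the old value at size 1 is at least 1.
  pathRooted-mono : ∀ s {k} → k < s + l → extend (pathRooted l s) k ≤ pathRooted l s (suc k)
  pathRooted-mono zero    {zero}  _   = ℕ.≤-reflexive (sym (cycleRooted-one 1≤l))
  pathRooted-mono zero    {suc k} k<l = cycleRooted-mono k<l
  pathRooted-mono (suc s) {zero}  _   = ℕ.≤-refl
  pathRooted-mono (suc s) {suc k} (s≤s k<) = pathRooted-mono s k<

-- Unicyclic graphs grow from their cycle

module _ {G : Graph n} {W W′ : Pred (Fin n) 0ℓ} {v w : Fin n} (P : Pendent G W W′ v w) where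

  leaf-≤ : ∀ {c} → (∀ k → AtMost (Rooted G W w k) (c k)) → ∀ k → AtMost (Rooted G W′ v (suc k)) (extend c k)
  leaf-≤ b zero    = AtMost-one (rooted-one G)
  leaf-≤ b (suc k) = leaf-rooted-≤ P (b (suc k))

  leaf-≥ : ∀ {c} → (∀ k → AtLeast (Rooted G W w k) (c k)) → ∀ k → AtLeast (Rooted G W′ v (suc k)) (extend c k)
  leaf-≥ b zero    = leaf-rooted-one P
  leaf-≥ b (suc k) = leaf-rooted-≥ P (b (suc k))

module _ {G : Graph n} {l : ℕ} {f : ℕ → Fin n} (ring : Ring G l f) where

  private
    1≤l : 1 ≤ l
    1≤l = ℕ.≤-trans (s≤s z≤n) (Ring.long ring)

    1+[l∸1] : suc (l ∸ 1) ≡ l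
    1+[l∸1] = ℕ.m+[n∸m]≡n 1≤l

  -- An arc with `l` vertices covers the ring, which gives the ring as a finite subset with a known
  -- size.
  ringSet : Subset n
  ringSet = vertices (arc f 0 (l ∸ 1))

  ∈-ringSet⁺ : ∀ {x} → OnRing f x → x ∈ ringSet
  ∈-ringSet⁺ (j , refl) = let i , i<l , eq = window ring 0 j in
    subst (_∈ ringSet) (sym eq) (∈-arc⁺ f 0 (s≤s⁻¹ (subst (i <_) (sym 1+[l∸1]) i<l)))

  ∈-ringSet⁻ : ∀ {x} → x ∈ ringSet → OnRing f x
  ∈-ringSet⁻ x∈ = let j , _ , eq = ∈-arc⁻ f 0 (l ∸ 1) x∈ in j , sym eq

  data Grown : ℕ → Subset n → Set where
    base : Grown 0 ringSet
    grow : ∀ {s W v w} → Grown s W → Pendent G (_∈ W) (_∈ insert W v) v w → Grown (suc s) (insert W v)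

  ∣grown∣ : ∀ {s W} → Grown s W → ∣ W ∣ ≡ s + l
  ∣grown∣ base = trans (IsSubtree.size (arc-subtree ring 0 (ℕ.≤-reflexive 1+[l∸1]))) 1+[l∸1]
  ∣grown∣ (grow {W = W} g P) = trans (∣insert∣ W (Pendent.fresh P)) (cong suc (∣grown∣ g))

  private
    fromRing : ∀ {k} → Subtrees G (OnRing f) k U.⊆ Subtrees G (_∈ ringSet) k
    fromRing (T , on) = T , λ x → ∈-ringSet⁺ ∘ on x

    toRing : ∀ {k} → Subtrees G (_∈ ringSet) k U.⊆ Subtrees G (OnRing f) k
    toRing (T , on) = T , λ x → ∈-ringSet⁻ ∘ on x

  -- The bound holds for every root, since the next attachment vertex may be anywhere in `W`. A new
  -- leaf as root is handled by `starRooted-extend`, an old root by `old-rooted-≤`.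
  grown-rooted-≤ : ∀ {s W r} → Grown s W → r ∈ W → ∀ k → AtMost (Rooted G (_∈ W) r k) (starRooted l s k)
  grown-rooted-≤ base r∈ k = AtMost-mono (λ (S , r∈) → toRing S , r∈) ℕ.≤-refl
    (cycle-rooted-≤ ring (∈-ringSet⁻ r∈) k)
  grown-rooted-≤ (grow g P) r∈ zero = AtMost-zero (rooted-zero G)
  grown-rooted-≤ {suc s} (grow g P) r∈ (suc k) with ∈-insert⁻ r∈
  ... | inj₁ refl = AtMost-mono id (starRooted-extend 1≤l s k)
    (leaf-≤ P (grown-rooted-≤ g (Pendent.attach P)) k)
  ... | inj₂ r∈W  = old-rooted-≤ P r∈W (grown-rooted-≤ g r∈W (suc k)) (grown-rooted-≤ g r∈W k)

  grown-subtrees-≤ : ∀ {s W} → Grown s W → ∀ k → AtMost (Subtrees G (_∈ W) (suc k)) (starTotal l s (suc k))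
  grown-subtrees-≤ base       k = AtMost-mono toRing ℕ.≤-refl (cycle-subtrees-≤ ring k)
  grown-subtrees-≤ (grow g P) k = subtrees-≤ P (grown-subtrees-≤ g k)
    (leaf-≤ P (grown-rooted-≤ g (Pendent.attach P)) k)

  -- For an old root the size `k + 1` is compared with `s + l`, the number of vertices of `W`.
  grown-rooted-≥ : ∀ {s W r} → Grown s W → r ∈ W → ∀ k → AtLeast (Rooted G (_∈ W) r k) (pathRooted l s k)
  grown-rooted-≥ base r∈ k = AtLeast-mono (λ (S , r∈) → fromRing S , r∈) ℕ.≤-refl
    (cycle-rooted-≥ ring (∈-ringSet⁻ r∈) k)
  grown-rooted-≥ (grow g P) r∈ zero = AtLeast-zero
  grown-rooted-≥ {suc s} {r = r} (grow {W = W} {v} g P) r∈ (suc k) with ∈-insert⁻ r∈ | ℕ.<-cmp k (s + l)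
  ... | inj₁ refl | _ = leaf-≥ P (grown-rooted-≥ g (Pendent.attach P)) k
  -- Subtrees inside `W` already suffice, because the path counts do not decrease in this range.
  ... | inj₂ r∈W | tri< k< _ _ = AtLeast-mono id (pathRooted-mono 1≤l s k<)
    (old-rooted-≥ P (grown-rooted-≥ g r∈W (suc k)))
  ... | inj₂ r∈W | tri> _ _ k> = AtLeast-mono id (ℕ.≤-reflexive (pathRooted-> 1≤l (suc s) (s≤s k>))) AtLeast-zero
  -- Here subtrees with `k + 1` vertices span `insert W v`, so those rooted at the new leaf also
  -- contain `r`.
  ... | inj₂ r∈W | tri≈ _ k≡ _ = AtLeast-mono (λ {H} (S , _) → S , spanning {H} S) ℕ.≤-refl
    (leaf-≥ P (grown-rooted-≥ g (Pendent.attach P)) k)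
    where
    spanning : ∀ {H} → Subtrees G (_∈ insert W v) (suc k) H → r ∈ vertices H
    spanning {H} (T , H⊆) = decidable-stable (r ∈? vertices H) λ r∉ →
      ℕ.<⇒≢ (p⊂q⇒∣p∣<∣q∣ ((λ {x} → H⊆ x) , r , r∈ , r∉))
        (trans (IsSubtree.size T) (trans (cong suc k≡) (sym (∣grown∣ (grow g P)))))

  grown-subtrees-≥ : ∀ {s W} → Grown s W → ∀ k → AtLeast (Subtrees G (_∈ W) (suc k)) (pathTotal l s (suc k))
  grown-subtrees-≥ base       k = AtLeast-mono fromRing ℕ.≤-refl (cycle-subtrees-≥ ring k)
  grown-subtrees-≥ (grow g P) k = subtrees-≥ P (grown-subtrees-≥ g k)
    (leaf-≥ P (grown-rooted-≥ g (Pendent.attach P)) k)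

-- Chordless cycles as periodic sequences

next-unique : ∀ {l i j j′} → j < l → j′ < l → CycleEdge l i j → CycleEdge l i j′ → j ≡ j′
next-unique _ _ (inj₁ (p , _)) (inj₁ (q , _)) = trans (sym p) q
next-unique j<l _ (inj₁ (p , _)) (inj₂ (q , _)) = contradiction (trans (sym p) q) (ℕ.<⇒≢ j<l)
next-unique _ j′<l (inj₂ (p , _)) (inj₁ (q , _)) = contradiction (trans (sym q) p) (ℕ.<⇒≢ j′<l)
next-unique _ _ (inj₂ (_ , p)) (inj₂ (_ , q)) = trans p (sym q)

prev-unique : ∀ {l i i′ j} → CycleEdge l i j → CycleEdge l i′ j → i ≡ i′
prev-unique (inj₁ (p , _)) (inj₁ (q , _)) = ℕ.suc-injective (trans p (sym q))
prev-unique (inj₁ (() , _)) (inj₂ (_ , refl))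
prev-unique (inj₂ (_ , refl)) (inj₁ (() , _))
prev-unique (inj₂ (p , _)) (inj₂ (q , _)) = ℕ.suc-injective (trans p (sym q))

module _ {l : ℕ} (3≤l : 3 ≤ l) where

  private
    instance
      l≢0 : NonZero l
      l≢0 = >-nonZero (ℕ.≤-trans (s≤s z≤n) 3≤l)

  mod : ℕ → Fin l
  mod j = fromℕ< (m%n<n j l)

  toℕ-mod : ∀ j → toℕ (mod j) ≡ j % l
  toℕ-mod j = Fin.toℕ-fromℕ< (m%n<n j l)

  mod-toℕ : ∀ i → mod (toℕ i) ≡ i
  mod-toℕ i = Fin.toℕ-injective (trans (toℕ-mod (toℕ i)) (m<n⇒m%n≡m (Fin.toℕ<n i)))

  mod-periodic : ∀ j → mod (j + l) ≡ mod j
  mod-periodic j = Fin.toℕ-injective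
    (trans (toℕ-mod (j + l)) (trans ([m+n]%n≡m%n j l) (sym (toℕ-mod j))))

  -- Equal remainders and `i < j` force a larger quotient for `j`, hence `i + l ≤ j`.
  mod-distinct : ∀ {i j} → i < j → j < i + l → mod i ≢ mod j
  mod-distinct {i} {j} i<j j<i+l eq = ℕ.<⇒≱ j<i+l (begin
    i + l                    ≡⟨ cong (_+ l) (m≡m%n+[m/n]*n i l) ⟩
    i % l + (i / l) * l + l  ≡⟨ ℕ.+-assoc (i % l) _ l ⟩
    i % l + ((i / l) * l + l) ≡⟨ cong (i % l +_) (ℕ.+-comm _ l) ⟩
    i % l + suc (i / l) * l  ≤⟨ ℕ.+-monoʳ-≤ (i % l) (ℕ.*-monoˡ-≤ l q<q′) ⟩
    i % l + (j / l) * l      ≡⟨ cong (_+ (j / l) * l) r≡r′ ⟩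
    j % l + (j / l) * l      ≡⟨ m≡m%n+[m/n]*n j l ⟨
    j                        ∎)
    where
    open ≤-Reasoning
    r≡r′ : i % l ≡ j % l
    r≡r′ = trans (sym (toℕ-mod i)) (trans (cong toℕ eq) (toℕ-mod j))

    q<q′ : i / l < j / l
    q<q′ = ℕ.*-cancelʳ-< l (i / l) (j / l) (ℕ.+-cancelˡ-< (i % l) _ _
      (subst₂ _<_ (m≡m%n+[m/n]*n i l)
        (trans (m≡m%n+[m/n]*n j l) (cong (_+ (j / l) * l) (sym r≡r′))) i<j))

  mod-next : ∀ j → CycleEdge l (toℕ (mod j)) (toℕ (mod (suc j)))
  mod-next j = subst₂ (CycleEdge l) (sym (toℕ-mod j)) (sym (toℕ-mod (suc j))) edge
    where
    suc-% : suc j % l ≡ suc (j % l) % l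
    suc-% = trans (%-distribˡ-+ 1 j l)
      (cong (λ u → (u + j % l) % l) (m<n⇒m%n≡m (ℕ.≤-trans (s≤s (s≤s z≤n)) 3≤l)))

    edge : CycleEdge l (j % l) (suc j % l)
    edge with ℕ.m≤n⇒m<n∨m≡n (m%n<n j l)
    ... | inj₁ lt = inj₁ (sym (trans suc-% (m<n⇒m%n≡m lt)) , m%n<n (suc j) l)
    ... | inj₂ eq = inj₂ (eq , trans suc-% (trans (cong (_% l) eq) (n%n≡0 l)))

  module _ {G : Graph n} (c : Fin l → Fin n) (c-injective : ∀ {i j} → c i ≡ c j → i ≡ j)
           (closed : ∀ i j → CycleEdge l (toℕ i) (toℕ j) → Adj G (c i) (c j))
           (chordless : ∀ i j → Adj G (c i) (c j) → CycleEdge l (toℕ i) (toℕ j) ⊎ CycleEdge l (toℕ j) (toℕ i))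
           where

    -- Serves both the labelled cycles of `US` and `UP` and the cycle of an arbitrary unicyclic
    -- graph. Chordlessness and uniqueness of successor and predecessor give `induced`.
    cycle⇒ring : Ring G l (c ∘ mod)
    cycle⇒ring = record
      { long     = 3≤l
      ; periodic = λ j → cong c (mod-periodic j)
      ; distinct = λ i<j j<i+l eq → mod-distinct i<j j<i+l (c-injective eq)
      ; adjacent = λ j → closed (mod j) (mod (suc j)) (mod-next j)
      ; induced  = λ i j e → Sum.map
          (λ e′ → cong c (Fin.toℕ-injective (next-unique (Fin.toℕ<n _) (Fin.toℕ<n _) e′ (mod-next (suc i)))))
          (λ e′ → cong c (Fin.toℕ-injective (prev-unique e′ (mod-next i))))
          (chordless (mod (suc i)) (mod j) e)
      }

-- The extremal graphs

-- Vertices of `US` and `UP` are labelled in order of attachment, so initial segments of labels are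
-- the stages of growth.
Below : ℕ → Pred (Fin n) 0ℓ
Below t x = toℕ x < t

below-pendent : ∀ {G : Graph n} {t v w} → toℕ v ≡ t → Below t w → Adj G v w →
  (∀ {x} → Below t x → Adj G v x → x ≡ w) → Pendent G (Below t) (Below (suc t)) v w
below-pendent {t = t} v≡t w<t v~w only = record
  { new    = ℕ.≤-reflexive (cong suc v≡t)
  ; old    = ℕ.m≤n⇒m≤1+n
  ; cover  = λ x≤t → [ inj₂ , (λ x≡t → inj₁ (Fin.toℕ-injective (trans x≡t (sym v≡t)))) ]′
      (ℕ.m≤n⇒m<n∨m≡n (s≤s⁻¹ x≤t))
  ; fresh  = λ v<t → ℕ.<⇒≢ v<t v≡t
  ; attach = w<t
  ; edge   = v~w
  ; only   = only
  }

-- The cycle on the labels below `l`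

module _ {n l : ℕ} (3≤l : 3 ≤ l) (l≤n : l ≤ n) (E : Rel ℕ 0ℓ) (E? : Decidable E)
         (cycle⊆E : ∀ {i j} → CycleEdge l i j → E i j)
         (E⊆cycle : ∀ {i j} → i < l → j < l → E i j → CycleEdge l i j) where

  private
    embed : Fin l → Fin n
    embed i = inject≤ i l≤n

    toℕ-embed : ∀ i → toℕ (embed i) ≡ toℕ i
    toℕ-embed i = Fin.toℕ-inject≤ i l≤n

  standardCycle : ℕ → Fin n
  standardCycle = embed ∘ mod 3≤l

  standardRing : Ring (fromEdges E E? n) l standardCycle
  standardRing = cycle⇒ring 3≤l embed (λ {i} {j} → Fin.inject≤-injective l≤n l≤n i j)
    (λ i j i→j →
      (λ eq → loopless i→j (trans (sym (toℕ-embed i)) (trans (cong toℕ eq) (toℕ-embed j)))) ,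
      inj₁ (cycle⊆E (subst₂ (CycleEdge l) (sym (toℕ-embed i)) (sym (toℕ-embed j)) i→j)))
    (λ i j (_ , e) → Sum.map (edge i j) (edge j i) e)
    where
    loopless : ∀ {i j} → CycleEdge l i j → i ≢ j
    loopless (inj₁ (p , _)) refl = contradiction (sym p) (ℕ.<⇒≢ ℕ.≤-refl)
    -- The wrap-around edge is a loop only for `l = 1`.
    loopless (inj₂ (p , refl)) refl with s≤s () ← subst (3 ≤_) (sym p) 3≤l

    edge : ∀ i j → E (toℕ (embed i)) (toℕ (embed j)) → CycleEdge l (toℕ i) (toℕ j)
    edge i j e = E⊆cycle (Fin.toℕ<n i) (Fin.toℕ<n j) (subst₂ E (toℕ-embed i) (toℕ-embed j) e)

  below⇒onRing : ∀ {x : Fin n} → Below l x → OnRing standardCycle x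
  below⇒onRing {x} x<l = toℕ x , Fin.toℕ-injective (trans (toℕ-embed (mod 3≤l (toℕ x)))
    (trans (toℕ-mod 3≤l (toℕ x)) (m<n⇒m%n≡m x<l)))
    where instance _ = >-nonZero (ℕ.≤-trans (s≤s z≤n) 3≤l)

  onRing⇒below : ∀ {x : Fin n} → OnRing standardCycle x → Below l x
  onRing⇒below (j , refl) = subst (_< l) (sym (toℕ-embed (mod 3≤l j))) (Fin.toℕ<n (mod 3≤l j))

module _ {n l : ℕ} (3≤l : 3 ≤ l) (l≤n : l ≤ n) where

  private
    0<l : 0 < l
    0<l = ℕ.≤-trans (s≤s z≤n) 3≤l

    usE⊆cycle : ∀ {i j} → i < l → j < l → USEdge l i j → CycleEdge l i j
    usE⊆cycle i<l j<l (inj₁ e)         = e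
    usE⊆cycle i<l j<l (inj₂ (_ , l≤j)) = contradiction l≤j (ℕ.<⇒≱ j<l)

    upE⊆cycle : ∀ {i j} → i < l → j < l → UPEdge l i j → CycleEdge l i j
    upE⊆cycle i<l j<l (inj₁ e)                  = e
    upE⊆cycle i<l j<l (inj₂ (inj₁ (_ , refl))) = contradiction refl (ℕ.<⇒≢ j<l)
    upE⊆cycle i<l j<l (inj₂ (inj₂ (l≤i , _)))  = contradiction l≤i (ℕ.<⇒≱ i<l)

    usRing = standardRing 3≤l l≤n (USEdge l) (usEdge? l) inj₁ usE⊆cycle
    upRing = standardRing 3≤l l≤n (UPEdge l) (upEdge? l) inj₁ upE⊆cycle

    cycle-bounds : ∀ {i j} → CycleEdge l i j → i < l × j < l
    cycle-bounds (inj₁ (refl , j<l)) = ℕ.<-trans ℕ.≤-refl j<l , j<l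
    cycle-bounds (inj₂ (refl , refl)) = ℕ.≤-refl , s≤s z≤n

  us-pendent : ∀ {s v w} → toℕ v ≡ s + l → toℕ w ≡ 0 →
    Pendent (US n l) (Below (s + l)) (Below (suc s + l)) v w
  us-pendent {s} {v} {w} v≡ w≡0 = below-pendent v≡ w< (≢-sym w≢v , inj₂ (inj₂ (w≡0 , l≤v))) only
    where
    l≤v : l ≤ toℕ v
    l≤v = subst (l ≤_) (sym v≡) (ℕ.m≤n+m l s)

    w< : toℕ w < s + l
    w< = subst (_< s + l) (sym w≡0) (ℕ.≤-trans 0<l (ℕ.m≤n+m l s))

    w≢v : w ≢ v
    w≢v refl = ℕ.<⇒≢ w< v≡

    only : ∀ {x} → Below (s + l) x → Adj (US n l) v x → x ≡ w
    only x< (_ , inj₁ (inj₁ e)) = contradiction l≤v (ℕ.<⇒≱ (proj₁ (cycle-bounds e)))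
    only x< (_ , inj₁ (inj₂ (v≡0 , _))) = contradiction (subst (l ≤_) v≡0 l≤v) (ℕ.<⇒≱ 0<l)
    only x< (_ , inj₂ (inj₁ e)) = contradiction l≤v (ℕ.<⇒≱ (proj₂ (cycle-bounds e)))
    only x< (_ , inj₂ (inj₂ (x≡0 , _))) = Fin.toℕ-injective (trans x≡0 (sym w≡0))

  -- For s = 0 the path is empty and pathEnd is the attachment vertex.
  pathEnd : ℕ → ℕ
  pathEnd zero    = 0
  pathEnd (suc s) = s + l

  pathEnd< : ∀ s → pathEnd s < s + l
  pathEnd< zero    = 0<l
  pathEnd< (suc s) = ℕ.≤-refl

  up-pendent : ∀ {s v w} → toℕ v ≡ s + l → toℕ w ≡ pathEnd s →
    Pendent (UP n l) (Below (s + l)) (Below (suc s + l)) v w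
  up-pendent {s} {v} {w} v≡ w≡ = below-pendent v≡ w< (≢-sym w≢v , inj₂ (inj₂ (link s v≡ w≡))) only
    where
    l≤v : l ≤ toℕ v
    l≤v = subst (l ≤_) (sym v≡) (ℕ.m≤n+m l s)

    w< : toℕ w < s + l
    w< = subst (_< s + l) (sym w≡) (pathEnd< s)

    w≢v : w ≢ v
    w≢v refl = ℕ.<⇒≢ w< v≡

    link : ∀ s {i j} → j ≡ s + l → i ≡ pathEnd s → (i ≡ 0 × j ≡ l) ⊎ (l ≤ i × j ≡ suc i)
    link zero    j≡ i≡ = inj₁ (i≡ , j≡)
    link (suc s) refl refl = inj₂ (ℕ.m≤n+m l s , refl)

    unlink : ∀ s {i j} → j ≡ s + l → (i ≡ 0 × j ≡ l) ⊎ (l ≤ i × j ≡ suc i) → i ≡ pathEnd s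
    unlink zero    j≡ (inj₁ (i≡0 , _)) = i≡0
    unlink zero    j≡ (inj₂ (l≤i , j≡1+i)) =
      contradiction l≤i (ℕ.<⇒≱ (ℕ.≤-reflexive (trans (sym j≡1+i) j≡)))
    unlink (suc s) j≡ (inj₁ (_ , j≡l)) =
      contradiction (trans (sym j≡l) j≡) (ℕ.<⇒≢ (s≤s (ℕ.m≤n+m l s)))
    unlink (suc s) j≡ (inj₂ (_ , j≡1+i)) = ℕ.suc-injective (trans (sym j≡1+i) j≡)

    only : ∀ {x} → Below (s + l) x → Adj (UP n l) v x → x ≡ w
    only x< (_ , inj₁ (inj₁ e)) = contradiction l≤v (ℕ.<⇒≱ (proj₁ (cycle-bounds e)))
    only x< (_ , inj₁ (inj₂ (inj₁ (v≡0 , _)))) = contradiction (subst (l ≤_) v≡0 l≤v) (ℕ.<⇒≱ 0<l)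
    only x< (_ , inj₁ (inj₂ (inj₂ (_ , x≡1+v)))) =
      contradiction x< (ℕ.≤⇒≯ (ℕ.≤-trans (ℕ.n≤1+n _) (ℕ.≤-reflexive (trans (cong suc (sym v≡)) (sym x≡1+v)))))
    only x< (_ , inj₂ (inj₁ e)) = contradiction l≤v (ℕ.<⇒≱ (proj₂ (cycle-bounds e)))
    only x< (_ , inj₂ (inj₂ e)) = Fin.toℕ-injective (trans (unlink s v≡ e) (sym w≡))

  private
    0<n : 0 < n
    0<n = ℕ.≤-trans 0<l l≤n

    centre : Fin n
    centre = fromℕ< 0<n

    toℕ-centre : toℕ centre ≡ 0
    toℕ-centre = Fin.toℕ-fromℕ< 0<n

  -- The root is the attachment vertex at every step, so `attach-rooted-≥` yields the full star
  -- recurrence.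
  us-rooted-≥ : ∀ s → s + l ≤ n → ∀ k → AtLeast (Rooted (US n l) (Below (s + l)) centre k) (starRooted l s k)
  us-rooted-≥ zero    _ k = AtLeast-mono
    (λ ((T , on) , r∈) → (T , λ x → onRing⇒below 3≤l l≤n (USEdge l) (usEdge? l) inj₁ usE⊆cycle ∘ on x) , r∈) ℕ.≤-refl
    (cycle-rooted-≥ usRing (below⇒onRing 3≤l l≤n (USEdge l) (usEdge? l) inj₁ usE⊆cycle (subst (_< l) (sym toℕ-centre) 0<l)) k)
  us-rooted-≥ (suc s) _ zero = AtLeast-zero
  us-rooted-≥ (suc s) s+l<n (suc k) = attach-rooted-≥ (us-pendent {s} (Fin.toℕ-fromℕ< s+l<n) toℕ-centre)
    (us-rooted-≥ s (ℕ.<⇒≤ s+l<n) (suc k)) (us-rooted-≥ s (ℕ.<⇒≤ s+l<n) k)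

  us-subtrees-≥ : ∀ s → s + l ≤ n → ∀ k → AtLeast (Subtrees (US n l) (Below (s + l)) (suc k)) (starTotal l s (suc k))
  us-subtrees-≥ zero    _ k = AtLeast-mono
    (λ (T , on) → T , λ x → onRing⇒below 3≤l l≤n (USEdge l) (usEdge? l) inj₁ usE⊆cycle ∘ on x) ℕ.≤-refl
    (cycle-subtrees-≥ usRing k)
  us-subtrees-≥ (suc s) s+l<n k =
    subtrees-≥ P (us-subtrees-≥ s (ℕ.<⇒≤ s+l<n) k) (leaf-≥ P (us-rooted-≥ s (ℕ.<⇒≤ s+l<n)) k)
    where P = us-pendent {s} (Fin.toℕ-fromℕ< s+l<n) toℕ-centre

  private
    tip : ∀ s → s + l ≤ n → Fin n
    tip s s+l≤n = fromℕ< (ℕ.≤-trans (pathEnd< s) s+l≤n)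

    toℕ-tip : ∀ s s+l≤n → toℕ (tip s s+l≤n) ≡ pathEnd s
    toℕ-tip s s+l≤n = Fin.toℕ-fromℕ< (ℕ.≤-trans (pathEnd< s) s+l≤n)

    tip-pendent : ∀ s (s+l<n : suc s + l ≤ n) →
      Pendent (UP n l) (Below (s + l)) (Below (suc s + l)) (tip (suc s) s+l<n) (tip s (ℕ.<⇒≤ s+l<n))
    tip-pendent s s+l<n = up-pendent (toℕ-tip (suc s) s+l<n) (toℕ-tip s (ℕ.<⇒≤ s+l<n))

  -- It is enough to follow subtrees through the current end of the path, since the next vertex is
  -- attached there.
  up-rooted-≤ : ∀ s (s+l≤n : s + l ≤ n) k →
    AtMost (Rooted (UP n l) (Below (s + l)) (tip s s+l≤n) k) (pathRooted l s k)
  up-rooted-≤ zero    l≤n′ k = AtMost-mono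
    (λ ((T , on) , r∈) → (T , λ x → below⇒onRing 3≤l l≤n (UPEdge l) (upEdge? l) inj₁ upE⊆cycle ∘ on x) , r∈) ℕ.≤-refl
    (cycle-rooted-≤ upRing (below⇒onRing 3≤l l≤n (UPEdge l) (upEdge? l) inj₁ upE⊆cycle
      (subst (_< l) (sym (toℕ-tip 0 l≤n′)) 0<l)) k)
  up-rooted-≤ (suc s) _     zero    = AtMost-zero (rooted-zero (UP n l))
  up-rooted-≤ (suc s) s+l<n (suc k) = leaf-≤ (tip-pendent s s+l<n) (up-rooted-≤ s (ℕ.<⇒≤ s+l<n)) k

  up-subtrees-≤ : ∀ s → s + l ≤ n → ∀ k → AtMost (Subtrees (UP n l) (Below (s + l)) (suc k)) (pathTotal l s (suc k))
  up-subtrees-≤ zero    _ k = AtMost-mono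
    (λ (T , on) → T , λ x → below⇒onRing 3≤l l≤n (UPEdge l) (upEdge? l) inj₁ upE⊆cycle ∘ on x) ℕ.≤-refl
    (cycle-subtrees-≤ upRing k)
  up-subtrees-≤ (suc s) s+l<n k = subtrees-≤ (tip-pendent s s+l<n) (up-subtrees-≤ s (ℕ.<⇒≤ s+l<n) k)
    (leaf-≤ (tip-pendent s s+l<n) (up-rooted-≤ s (ℕ.<⇒≤ s+l<n)) k)

-- Simple paths and cycles

module _ {R : Rel (Fin n) 0ℓ} where

  data Path : ∀ {m} → Fin n → Fin n → Vec (Fin n) (suc m) → Set where
    [_] : ∀ v → Path v v (v ∷ [])
    _∷⟨_⟩_ : ∀ {m x y v} {p : Vec (Fin n) (suc m)} →
      R x y → (∀ i → lookup p i ≢ x) → Path y v p → Path x v (x ∷ p)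

  path-suffix : ∀ {m x v} {p : Vec (Fin n) (suc m)} → Path x v p → ∀ i →
    ∃₂ λ m′ (q : Vec (Fin n) (suc m′)) → Path (lookup p i) v q
  path-suffix P zero with P
  ... | [ v ]        = _ , _ , P
  ... | _ ∷⟨ _ ⟩ _   = _ , _ , P
  path-suffix (_ ∷⟨ _ ⟩ P) (suc i) = path-suffix P i

  -- Loop erasure: if `x` occurs again on the path built for the rest of the walk, the part before
  -- that occurrence is dropped.
  star⇒path : ∀ {x v} → Star R x v → ∃₂ λ m (p : Vec (Fin n) (suc m)) → Path x v p
  star⇒path ε = _ , _ , [ _ ]
  star⇒path {x} (r ◅ rs) with star⇒path rs
  ... | m , p , P with Fin.any? (λ i → lookup p i Fin.≟ x)
  ... | yes (i , refl) = path-suffix P i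
  ... | no  x∉         = _ , _ , (r ∷⟨ (λ i eq → x∉ (i , eq)) ⟩ P)

  path-first : ∀ {m x v} {p : Vec (Fin n) (suc m)} → Path x v p → lookup p zero ≡ x
  path-first [ _ ]        = refl
  path-first (_ ∷⟨ _ ⟩ _) = refl

  path-last : ∀ {m x v} {p : Vec (Fin n) (suc m)} → Path x v p → ∀ i → toℕ i ≡ m → lookup p i ≡ v
  path-last [ _ ]        zero    _  = refl
  path-last (_ ∷⟨ _ ⟩ P) (suc i) eq = path-last P i (ℕ.suc-injective eq)

  path-step : ∀ {m x v} {p : Vec (Fin n) (suc m)} → Path x v p →
    ∀ i j → suc (toℕ i) ≡ toℕ j → R (lookup p i) (lookup p j)
  path-step (r ∷⟨ _ ⟩ P) zero (suc zero) _ = subst (R _) (sym (path-first P)) r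
  path-step (_ ∷⟨ _ ⟩ P) (suc i) (suc j) eq = path-step P i j (ℕ.suc-injective eq)

  path-distinct : ∀ {m x v} {p : Vec (Fin n) (suc m)} → Path x v p → Injective _≡_ _≡_ (lookup p)
  path-distinct [ _ ]         {zero}  {zero}  _  = refl
  path-distinct (_ ∷⟨ _ ⟩ _)  {zero}  {zero}  _  = refl
  path-distinct (_ ∷⟨ x∉ ⟩ _) {zero}  {suc j} eq = contradiction (sym eq) (x∉ j)
  path-distinct (_ ∷⟨ x∉ ⟩ _) {suc i} {zero}  eq = contradiction eq (x∉ i)
  path-distinct (_ ∷⟨ _ ⟩ P)  {suc i} {suc j} eq = cong suc (path-distinct P eq)

module _ {G : Graph n} {R : Rel (Fin n) 0ℓ} (R⊆Adj : ∀ {x y} → R x y → Adj G x y) where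

  -- A path with at least three vertices closes up through the edge between `v` and `u`. Shorter
  -- ones are impossible: one vertex would make `u` adjacent to itself, two would give `R u v`.
  close-path : ∀ {u v m} {p : Vec (Fin n) (suc m)} → Adj G u v → ¬ R u v → Path {R = R} u v p →
    ∃ λ (C : Cycle (Adj G)) → Cycle.On C u v
  close-path u~v ¬r [ _ ] = contradiction u~v (Graph.irrefl G refl)
  close-path u~v ¬r (r ∷⟨ _ ⟩ [ _ ]) = contradiction r ¬r
  close-path {u} {v} {suc (suc m)} {p} u~v _ P@(_ ∷⟨ _ ⟩ (_ ∷⟨ _ ⟩ _)) =
    cycle p record { long = s≤s (s≤s (s≤s z≤n)) ; distinct = path-distinct P ; closed = closed } ,
    -- The closing edge leads from the last position back to position 0.
    end , zero , inj₂ (cong suc toℕ-end , refl) , inj₂ (refl , sym (path-last P end toℕ-end))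
    where
    end : Fin (3 + m)
    end = fromℕ (2 + m)

    toℕ-end : toℕ end ≡ 2 + m
    toℕ-end = Fin.toℕ-fromℕ (2 + m)

    closed : ∀ i j → CycleEdge (3 + m) (toℕ i) (toℕ j) → Adj G (lookup p i) (lookup p j)
    closed i j    (inj₁ (eq , _)) = R⊆Adj (path-step P i j eq)
    closed i zero (inj₂ (eq , _)) =
      subst (λ x → Adj G x u) (sym (path-last P i (ℕ.suc-injective eq))) (Graph.sym G u~v)

  close : ∀ {u v} → Adj G u v → ¬ R u v → Star R u v → ∃ λ (C : Cycle (Adj G)) → Cycle.On C u v
  close u~v ¬r rs = close-path u~v ¬r (proj₂ (proj₂ (star⇒path rs)))

-- Unicyclic graphs

module _ {G : Graph n} (U : Unicyclic G) where

  open Unicyclic U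
  open Cycle theCycle using (On; isCycle) renaming (length to l; vertices to c)
  open IsCycle isCycle using (long; distinct; closed)

  private
    on? : Decidable On
    on? u v = Fin.any? λ i → Fin.any? λ j → cycleEdge? l (toℕ i) (toℕ j) ×-dec
      ((u Fin.≟ lookup c i ×-dec v Fin.≟ lookup c j) ⊎-dec (u Fin.≟ lookup c j ×-dec v Fin.≟ lookup c i))

    on-sym : Symmetric On
    on-sym (i , j , e , o) = i , j , e , Sum.map swap swap (Sum.swap o)

    on⇒adj : ∀ {u v} → On u v → Adj G u v
    on⇒adj (i , j , e , inj₁ (refl , refl)) = closed i j e
    on⇒adj (i , j , e , inj₂ (refl , refl)) = Graph.sym G (closed i j e)

    around : ∀ a → Star On (lookup c (mod long 0)) (lookup c (mod long a))
    around zero    = ε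
    around (suc a) = around a ◅◅ (_ , _ , mod-next long a , inj₁ (refl , refl)) ◅ ε

    around′ : ∀ i → Star On (lookup c (mod long 0)) (lookup c i)
    around′ i = subst (Star On _ ∘ lookup c) (mod-toℕ long i) (around (toℕ i))

    -- Closing the walk gives a cycle through the edge, hence the only cycle.
    close-on : ∀ {R : Rel (Fin n) 0ℓ} → (∀ {x y} → R x y → Adj G x y) →
      ∀ {u v} → Adj G u v → ¬ R u v → Star R u v → On u v
    close-on R⊆Adj u~v ¬r rs = let C , on = close {G = G} R⊆Adj u~v ¬r rs in
      Equivalence.from (uniqueCycle C _ _) on

    -- A chord off the cycle would close a walk along the cycle into a cycle containing the chord,
    -- so by uniqueness it would be on the cycle after all.
    chord-on : ∀ i j → Adj G (lookup c i) (lookup c j) → On (lookup c i) (lookup c j)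
    chord-on i j e = decidable-stable (on? _ _) λ ¬on →
      ¬on (close-on on⇒adj e ¬on (Star.reverse on-sym (around′ i) ◅◅ around′ j))

    chordless : ∀ i j → Adj G (lookup c i) (lookup c j) →
      CycleEdge l (toℕ i) (toℕ j) ⊎ CycleEdge l (toℕ j) (toℕ i)
    chordless i j e with chord-on i j e
    ... | i′ , j′ , i→j , inj₁ (p , q) with refl ← distinct p | refl ← distinct q = inj₁ i→j
    ... | i′ , j′ , i→j , inj₂ (p , q) with refl ← distinct p | refl ← distinct q = inj₂ i→j

  ring : Ring G l (lookup c ∘ mod long)
  ring = cycle⇒ring long (lookup c) distinct closed chordless

  -- Growing a unicyclic graph from its cycle

  private
    f : ℕ → Fin n
    f = lookup c ∘ mod long

    AdjIn : Subset n → Rel (Fin n) 0ℓ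
    AdjIn W x y = Adj G x y × x ∈ W × y ∈ W

    ring⊆ : ∀ {s W} → Grown ring s W → ∀ j → f j ∈ W
    ring⊆ base       j = ∈-ringSet⁺ ring (j , refl)
    ring⊆ (grow g P) j = ∈-insert⁺ (ring⊆ g j)

    -- The walk stays inside `W`; this is what later keeps it away from a vertex outside `W`.
    grown-reach : ∀ {s W x} → Grown ring s W → x ∈ W → Star (AdjIn W) (f 0) x
    grown-reach base x∈ with ∈-ringSet⁻ ring x∈
    ... | j , refl = walk j
      where
      walk : ∀ j → Star (AdjIn (ringSet ring)) (f 0) (f j)
      walk zero    = ε
      walk (suc j) = walk j ◅◅ (Ring.adjacent ring j , ring⊆ base j , ring⊆ base (suc j)) ◅ ε
    grown-reach (grow {W = W} {v} g P) x∈ with ∈-insert⁻ x∈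
    ... | inj₂ x∈W = Star.map (λ (e , y∈ , z∈) → e , ∈-insert⁺ y∈ , ∈-insert⁺ z∈) (grown-reach g x∈W)
    ... | inj₁ refl = Star.map (λ (e , y∈ , z∈) → e , ∈-insert⁺ y∈ , ∈-insert⁺ z∈) (grown-reach g attach)
        ◅◅ (Graph.sym G edge , ∈-insert⁺ attach , x∈insert) ◅ ε
      where open Pendent P

    grown-walk : ∀ {s W x y} → Grown ring s W → x ∈ W → y ∈ W → Star (AdjIn W) x y
    grown-walk g x∈ y∈ =
      Star.reverse (λ (e , p , q) → Graph.sym G e , q , p) (grown-reach g x∈) ◅◅ grown-reach g y∈

    -- A second neighbour `x` would give a walk from `v` through `x` and `W` to `w`. Closing it with
    -- the edge between `v` and `w` yields a cycle through `v`, but the only cycle lies in `W`.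
    one-neighbour : ∀ {s W v w x} → Grown ring s W → v ∉ W → w ∈ W → Adj G v w → x ∈ W → Adj G v x → x ≡ w
    one-neighbour {W = W} {v} {w} {x} g v∉ w∈ v~w x∈ v~x = decidable-stable (x Fin.≟ w) λ x≢w →
      let R : Rel (Fin n) 0ℓ
          -- The relation omits the edge from `v` to `w`, as `close-on` requires, and contains `v`
          -- only as the source of the edge to `x`.
          R y z = (y ≡ v × z ≡ x) ⊎ AdjIn W y z
      in off-ring (close-on {R} [ (λ { (refl , refl) → v~x }) , proj₁ ]′ v~w
        [ (λ (_ , w≡x) → x≢w (sym w≡x)) , (λ (_ , v∈ , _) → v∉ v∈) ]′
        (inj₁ (refl , refl) ◅ Star.map inj₂ (grown-walk g x∈ w∈)))
      where
      v≢ : ∀ i → v ≢ lookup c i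
      v≢ i refl = v∉ (subst (λ i → lookup c i ∈ W) (mod-toℕ long i) (ring⊆ g (toℕ i)))

      off-ring : ¬ On v w
      off-ring (i , j , _ , inj₁ (v≡ , _)) = v≢ i v≡
      off-ring (i , j , _ , inj₂ (v≡ , _)) = v≢ j v≡

    exit : ∀ {W x y} → Star (Adj G) x y → x ∈ W → y ∉ W → ∃₂ λ w v → w ∈ W × v ∉ W × Adj G w v
    exit ε x∈ y∉ = contradiction x∈ y∉
    exit {W} (_◅_ {j = z} e es) x∈ y∉ with z ∈? W
    ... | yes z∈ = exit es z∈ y∉
    ... | no  z∉ = _ , _ , x∈ , z∉ , e

    outside-element : ∀ {W : Subset n} → ∣ W ∣ < n → ∃ (_∉ W)
    outside-element {W} ∣W∣<n = Fin.¬∀⟶∃¬ n (_∈ W) (_∈? W) λ all →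
      ℕ.<⇒≱ ∣W∣<n (subst (_≤ ∣ W ∣) (∣⊤∣≡n n) (p⊆q⇒∣p∣≤∣q∣ {p = ⊤} (λ {x} _ → all x)))

    -- While a vertex is missing, connectedness supplies an edge leaving `W`, and `one-neighbour`
    -- makes its outer end pendent. `d` counts the vertices still to be added.
    grow-on : ∀ d {s W} → Grown ring s W → d + (s + l) ≡ n →
      ∃ λ W′ → Grown ring (d + s) W′ × ∣ W′ ∣ ≡ n
    grow-on zero    g eq = _ , g , trans (∣grown∣ ring g) eq
    grow-on (suc d) {s} {W} g eq =
      let x , x∉ = outside-element {W} (subst₂ _<_ (sym (∣grown∣ ring g)) eq (s≤s (ℕ.m≤n+m (s + l) d)))
          w , v , w∈ , v∉ , w~v = exit (connected (f 0) x) (ring⊆ g 0) x∉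
          v~w = Graph.sym G w~v
          P = record
            { new    = x∈insert
            ; old    = ∈-insert⁺
            ; cover  = ∈-insert⁻
            ; fresh  = v∉
            ; attach = w∈
            ; edge   = v~w
            ; only   = one-neighbour g v∉ w∈ v~w
            }
          W′ , g′ , full = grow-on d (grow g P) (trans (ℕ.+-suc d (s + l)) eq)
      in W′ , subst (λ t → Grown ring t W′) (ℕ.+-suc d s) g′ , full

  grow-everything : l ≤ n → Grown ring (n ∸ l) ⊤
  grow-everything l≤n =
    let W , g , full = grow-on (n ∸ l) base (ℕ.m∸n+n≡m l≤n)
    in subst₂ (Grown ring) (ℕ.+-identityʳ (n ∸ l)) (∣p∣≡n⇒p≡⊤ full) g

theorem10 : (n l : ℕ) → n ≥ l → l ≥ 3 →
    (G : Graph n) (U : Unicyclic G) → girth U ≡ l →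
    (k : ℕ) →
    numSubtrees (US n l) k ≥ numSubtrees G k × numSubtrees G k ≥ numSubtrees (UP n l) k
theorem10 n l n≥l l≥3 G U refl zero = ℕ.≤-refl , ℕ.≤-refl
theorem10 n l n≥l l≥3 G U refl (suc k) =
  -- With `s = n ∸ l`, `starTotal` separates `G` from `US`, and below `pathTotal` separates `UP`
  -- from `G`.
  ℕ.≤-trans
    (numSubtrees-≤ G k (AtMost-mono (λ T → T , λ _ _ → ∈⊤) ℕ.≤-refl (grown-subtrees-≤ (ring U) growth k)))
    (numSubtrees-≥ (US n l) k (AtLeast-mono proj₁ ℕ.≤-refl (us-subtrees-≥ l≥3 n≥l (n ∸ l) size≤n k))) ,
  ℕ.≤-trans
    (numSubtrees-≤ (UP n l) k (AtMost-mono (λ T → T , λ x _ → below x) ℕ.≤-refl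
      (up-subtrees-≤ l≥3 n≥l (n ∸ l) size≤n k)))
    (numSubtrees-≥ G k (AtLeast-mono proj₁ ℕ.≤-refl (grown-subtrees-≥ (ring U) growth k)))
  where
  growth = grow-everything U n≥l

  size≤n : n ∸ l + l ≤ n
  size≤n = ℕ.≤-reflexive (ℕ.m∸n+n≡m n≥l)

  below : ∀ (x : Fin n) → Below (n ∸ l + l) x
  below x = subst (toℕ x <_) (sym (ℕ.m∸n+n≡m n≥l)) (Fin.toℕ<n x)
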